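{- Let $k \geq 3$ be a fixed integer, and for each $n$ let $G = G_n$ be an $n$-vertex graph with maximum degree $\Delta := \Delta(n)$. Let $m = m(n)$ be an integer with $m \gg n^{1/k^2} \Delta^{1/k}$ (i.e. $m / (n^{1/k^2}\Delta^{1/k}) \to \infty$ as $n\to\infty$) and $m \geq 3 k^2 \Delta$. Then $G$ is a.a.s. $(k,m)$-colourable.
   Context: Given positive integers $k \leq m$ and a graph $G$, a family of lists $\mathcal{L} = \{L(v) : v \in V(G)\}$ is a random $(k,m)$-list-assignment if for every $v \in V(G)$ the list $L(v)$ is a $k$-element subset of $\{1, \ldots, m\}$ chosen uniformly at random, independently of all other vertices. $G$ is $\mathcal{L}$-colourable if there is a proper colouring $c$ of $G$ with $c(v) \in L(v)$ for every $v$. An $n$-vertex graph $G$ is a.a.s. $(k,m)$-colourable if $\lim_{n \to \infty} \mathbb{P}(G \text{ is } \mathcal{L}\text{ -colourable}) = 1$, where $\mathcal{L}$ is a random $(k,m)$-list-assignment. -}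

module Defs where

open import Data.Nat using (ℕ; zero; suc; _+_; _*_; _^_; _≤_; _⊔_)
open import Data.Nat.Combinatorics using (_C_)
open import Data.Bool using (Bool; true; false)
open import Data.Fin using (Fin)
open import Data.Fin.Subset using (Subset; _∈_; ∣_∣)
open import Data.Vec using (Vec; lookup; tabulate; foldr)
open import Data.List using (List; length)
open import Data.List.Relation.Unary.Unique.Propositional using (Unique)
import Data.List.Membership.Propositional as LM
open import Data.Product using (Σ; _×_; ∃)
open import Relation.Binary.PropositionalEquality using (_≡_; _≢_)
open import Relation.Nullary using (¬_)

record Graph (n : ℕ) : Set where
  field
    adj   : Fin n → Fin n → Bool
    sym   : ∀ u v → adj u v ≡ adj v u
    irref : ∀ v → adj v v ≡ false
open Graph public

degree : ∀ {n} → Graph n → Fin n → ℕ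
degree G v = ∣ tabulate (adj G v) ∣

maxDegree : ∀ {n} → Graph n → ℕ
maxDegree {n} G = foldr (λ _ → ℕ) _⊔_ 0 (tabulate (degree G))

ListAssignment : ℕ → ℕ → Set
ListAssignment n m = Vec (Subset m) n

IsKLists : ∀ {n m} → ℕ → ListAssignment n m → Set
IsKLists {n} k L = (v : Fin n) → ∣ lookup L v ∣ ≡ k

Colourable : ∀ {n m} → Graph n → ListAssignment n m → Set
Colourable {n} {m} G L =
  Σ (Fin n → Fin m) λ c →
    ((v : Fin n) → c v ∈ lookup L v) ×
    ((u v : Fin n) → adj G u v ≡ true → c u ≢ c v)

-- P(G not L-colourable) ≤ 1/(j+1) for a uniformly random (k,m)-list-assignment L:
-- there is a set S (duplicate-free list) of list assignments containing every
-- non-colourable (k,m)-list-assignment, with (j+1)·|S| ≤ (m choose k)^n,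
-- the latter being the number of all (k,m)-list-assignments (uniform space).
FailProbAtMost : ∀ {n} → Graph n → (k m j : ℕ) → Set
FailProbAtMost {n} G k m j =
  Σ (List (ListAssignment n m)) λ S →
    Unique S ×
    (suc j * length S ≤ (m C k) ^ n) ×
    ((L : ListAssignment n m) → IsKLists k L → ¬ (L LM.∈ S) → Colourable G L)

{-# OPTIONS --safe #-}
module Submission where

-- A non-colourable list assignment has, among the subgraphs connected through conflict
-- edges (edges of G whose ends have lists that meet), one on s vertices whose lists have at
-- most (k-1)(s-1) + k - k(k-1) colours: a vertex set either splits along a cut without
-- conflicts, or satisfies Hall's condition, or has a violator T, for which
-- (k-1)|T| - |⋃L(T)| is large, and adding vertices along conflict edges never decreases
-- this quantity. So a spanning tree of the subgraph has k(k-1) repeated colours beyond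
-- those which its edges force. A union bound over embedded trees (at most
-- 3 (35Δ/12)^(s-1) per root, where 35/12 < 3) with an exponential Markov inequality for
-- the number of repetitions gives probability O(n Δᵏ m^(-k²)) · poly(s) (71/72)ˢ for size s.

open import Defs hiding (sym)
open import Data.Bool using (Bool; true; false)
import Data.Bool.Properties as BP
open import Data.Fin using (Fin; zero; suc)
import Data.Fin.Properties as FP
open import Data.Fin.Subset using (Subset; _∈_; _∉_; _⊆_; _∪_; _∩_; _─_; _-_; ∣_∣; ⁅_⁆; Nonempty; ∁) renaming (⊤ to full; ⊥ to ∅)
open import Data.Fin.Subset.Properties
open import Data.List using (List; []; _∷_; length; filter; map; _++_; allFin; cartesianProductWith; downFrom)
import Data.List.Membership.Propositional as LM
open import Data.List.Membership.Propositional.Properties using (∈-map⁺; ∈-map⁻; ∈-++⁺ˡ; ∈-++⁺ʳ; ∈-++⁻; ∈-allFin; ∈-downFrom⁺; ∈-filter⁺; ∈-cartesianProductWith⁺; ∈-cartesianProductWith⁻)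
open import Data.List.Properties using (length-map; length-++; length-tabulate)
import Data.List.Relation.Unary.All as All
import Data.List.Relation.Unary.AllPairs as AP
open import Data.List.Relation.Unary.Any using () renaming (here to hereᴸ; there to thereᴸ)
open import Data.List.Relation.Unary.Unique.Propositional using (Unique)
import Data.List.Relation.Unary.Unique.Propositional.Properties as UP
open import Data.Nat hiding (∣_-_∣)
open import Data.Nat.Combinatorics using (_C_; nCk+nC[k+1]≡[n+1]C[k+1])
open import Data.Nat.DivMod using (m≡m%n+[m/n]*n; m/n*n≤m; m%n<n)
open import Data.Nat.Induction using (<-wellFounded)
open import Data.Nat.Properties
open import Data.Nat.Tactic.RingSolver using (solve-∀)
open import Data.Product using (Σ; ∃; _×_; _,_; proj₁; proj₂)
open import Data.Sum using (_⊎_; inj₁; inj₂)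
import Data.Unit as U
open import Data.Vec using (Vec; []; _∷_; lookup; here; there)
import Data.Vec as V
import Data.Vec.Properties as VP
open import Function using (_∘_)
open import Induction.WellFounded using (Acc; acc)
open import Relation.Binary.PropositionalEquality
open import Relation.Nullary using (¬_; Dec; yes; no; contradiction)
open import Relation.Nullary.Decidable using (_×-dec_; ¬?)

-- The constants come from an account kept per tree edge. Counting trees costs 35Δ/12, a list
-- meeting its parent's list has probability about k²/m, and weighting the further repetitions costs
-- at most 71/70. Since m ≥ 3k²Δ, the product is at most (35/12)(71/70)/3 = 71/72. The factor that
-- does not depend on the size has two sources. The k(k-1) excess repetitions give m^(-k(k-1)). A
-- violator has more than k vertices, so its tree has at least k edges; for k of them the ratio Δ/m
-- is kept instead of being traded for a constant, which gives Δᵏ m^(-k). The product Δᵏ m^(-k²) is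
-- exactly what the growth hypothesis controls. The base Y of the exponential weight is about
-- m/(71k²s), as large as the 71/70 permits. Its dependence on s is the source of the polynomial
-- factor, which (71/72)ˢ absorbs with enough to spare for a sum over all s. Probabilities appear as
-- counts of list assignments, with all denominators multiplied out.

private variable
  m n : ℕ
  A B : Set

-- Cardinalities of finite sets.

∣p∪q∣+∣p∩q∣ : (p q : Subset n) → ∣ p ∪ q ∣ + ∣ p ∩ q ∣ ≡ ∣ p ∣ + ∣ q ∣
∣p∪q∣+∣p∩q∣ [] [] = refl
∣p∪q∣+∣p∩q∣ (true ∷ p) (true ∷ q) = cong suc (trans (+-suc _ _) (trans (cong suc (∣p∪q∣+∣p∩q∣ p q)) (sym (+-suc _ _))))
∣p∪q∣+∣p∩q∣ (true ∷ p) (false ∷ q) = cong suc (∣p∪q∣+∣p∩q∣ p q)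
∣p∪q∣+∣p∩q∣ (false ∷ p) (true ∷ q) = trans (cong suc (∣p∪q∣+∣p∩q∣ p q)) (sym (+-suc _ _))
∣p∪q∣+∣p∩q∣ (false ∷ p) (false ∷ q) = ∣p∪q∣+∣p∩q∣ p q

x∈p-y⁻ : (p : Subset n) {x y : Fin n} → x ∈ p - y → x ∈ p × x ≢ y
x∈p-y⁻ p {x} {y} x∈ = p─q⊆p p ⁅ y ⁆ x∈ , λ where refl → helper p x x∈
  where
  helper : (p : Subset n) (x : Fin n) → x ∉ p - x
  helper (_ ∷ p) (suc x) (there h) = helper p x h

∣p∣≤1+∣p-x∣ : (p : Subset n) (x : Fin n) → ∣ p ∣ ≤ suc ∣ p - x ∣
∣p∣≤1+∣p-x∣ p x = begin
  ∣ p ∣                    ≤⟨ p⊆q⇒∣p∣≤∣q∣ sub ⟩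
  ∣ ⁅ x ⁆ ∪ (p - x) ∣      ≤⟨ m≤m+n _ _ ⟩
  _                        ≡⟨ ∣p∪q∣+∣p∩q∣ ⁅ x ⁆ (p - x) ⟩
  ∣ ⁅ x ⁆ ∣ + ∣ p - x ∣    ≡⟨ cong (_+ ∣ p - x ∣) (∣⁅x⁆∣≡1 x) ⟩
  suc ∣ p - x ∣            ∎
  where
  open ≤-Reasoning
  sub : p ⊆ ⁅ x ⁆ ∪ (p - x)
  sub {y} y∈p with y FP.≟ x
  ... | yes refl = x∈p∪q⁺ (inj₁ (x∈⁅x⁆ x))
  ... | no y≢x   = x∈p∪q⁺ (inj₂ (x∈p∧x≢y⇒x∈p-y y∈p y≢x))

p⊆q∧∣q∣≤∣p∣⇒q⊆p : {p q : Subset n} → p ⊆ q → ∣ q ∣ ≤ ∣ p ∣ → q ⊆ p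
p⊆q∧∣q∣≤∣p∣⇒q⊆p {p = p} p⊆q q≤p {x} x∈q with x ∈? p
... | yes x∈p = x∈p
... | no  x∉p = contradiction (p⊂q⇒∣p∣<∣q∣ (p⊆q , x , x∈q , x∉p)) (≤⇒≯ q≤p)

-- Unions of lists and Hall's marriage theorem.

⋃[_]_ : Subset n → Vec (Subset m) n → Subset m
⋃[ [] ] [] = ∅
⋃[ true ∷ S ] (X ∷ A) = X ∪ ⋃[ S ] A
⋃[ false ∷ S ] (X ∷ A) = ⋃[ S ] A

∈⋃⁺ : (S : Subset n) (A : Vec (Subset m) n) {v : Fin n} {x : Fin m} → v ∈ S → x ∈ lookup A v → x ∈ ⋃[ S ] A
∈⋃⁺ (true ∷ S) (X ∷ A) here x∈ = x∈p∪q⁺ (inj₁ x∈)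
∈⋃⁺ (true ∷ S) (X ∷ A) (there v∈) x∈ = x∈p∪q⁺ (inj₂ (∈⋃⁺ S A v∈ x∈))
∈⋃⁺ (false ∷ S) (X ∷ A) (there v∈) x∈ = ∈⋃⁺ S A v∈ x∈

∈⋃⁻ : (S : Subset n) (A : Vec (Subset m) n) {x : Fin m} → x ∈ ⋃[ S ] A → ∃ λ v → v ∈ S × x ∈ lookup A v
∈⋃⁻ [] [] x∈ = contradiction x∈ ∉⊥
∈⋃⁻ (true ∷ S) (X ∷ A) x∈ with x∈p∪q⁻ X _ x∈
... | inj₁ x∈X = zero , here , x∈X
... | inj₂ x∈U with v , v∈ , h ← ∈⋃⁻ S A x∈U = suc v , there v∈ , h
∈⋃⁻ (false ∷ S) (X ∷ A) x∈ with v , v∈ , h ← ∈⋃⁻ S A x∈ = suc v , there v∈ , h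

⋃-mono : {S S′ : Subset n} (A : Vec (Subset m) n) → S ⊆ S′ → ⋃[ S ] A ⊆ ⋃[ S′ ] A
⋃-mono {S = S} {S′} A S⊆S′ x∈ with v , v∈ , h ← ∈⋃⁻ S A x∈ = ∈⋃⁺ S′ A (S⊆S′ v∈) h

HallCondition : Vec (Subset m) n → Subset n → Set
HallCondition A H = ∀ S → S ⊆ H → ∣ S ∣ ≤ ∣ ⋃[ S ] A ∣

hall? : (A : Vec (Subset m) n) (H : Subset n) →
        HallCondition A H ⊎ ∃ λ S → S ⊆ H × ∣ ⋃[ S ] A ∣ < ∣ S ∣
hall? A H with anySubset? (λ S → (S ⊆? H) ×-dec (∣ ⋃[ S ] A ∣ <? ∣ S ∣))
... | yes (S , S⊆H , lt) = inj₂ (S , S⊆H , lt)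
... | no  none = inj₁ λ S S⊆H → ≮⇒≥ λ lt → none (S , S⊆H , lt)

record SDR (A : Vec (Subset m) n) (H : Subset n) : Set where
  constructor sdr
  field
    rep      : Fin n → Fin m
    rep∈     : ∀ {v} → v ∈ H → rep v ∈ lookup A v
    distinct : ∀ {u v} → u ∈ H → v ∈ H → rep u ≡ rep v → u ≡ v

Tight : Vec (Subset m) n → Subset n → Subset n → Set
Tight A H S = S ⊆ H × ∣ ⋃[ S ] A ∣ ≡ ∣ S ∣

-- Uncrossing: the size of the union of lists is submodular in the vertex set, and Hall's condition
-- bounds it from below on `S ∩ S′`.
tight-∪ : (A : Vec (Subset m) n) {H S S′ : Subset n} → HallCondition A H →
          Tight A H S → Tight A H S′ → Tight A H (S ∪ S′)
tight-∪ A {H} {S} {S′} hc (S⊆ , tS) (S′⊆ , tS′) = ∪⊆ , ≤-antisym upper (hc _ ∪⊆)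
  where
  ∪⊆ : S ∪ S′ ⊆ H
  ∪⊆ x∈ with x∈p∪q⁻ S S′ x∈
  ... | inj₁ h = S⊆ h
  ... | inj₂ h = S′⊆ h
  ⋃∪ : ⋃[ S ∪ S′ ] A ⊆ ⋃[ S ] A ∪ ⋃[ S′ ] A
  ⋃∪ x∈ with v , v∈ , h ← ∈⋃⁻ (S ∪ S′) A x∈ with x∈p∪q⁻ S S′ v∈
  ... | inj₁ v∈S = x∈p∪q⁺ (inj₁ (∈⋃⁺ S A v∈S h))
  ... | inj₂ v∈S′ = x∈p∪q⁺ (inj₂ (∈⋃⁺ S′ A v∈S′ h))
  ⋃∩ : ⋃[ S ∩ S′ ] A ⊆ ⋃[ S ] A ∩ ⋃[ S′ ] A
  ⋃∩ x∈ = x∈p∩q⁺ (⋃-mono A (p∩q⊆p S S′) x∈ , ⋃-mono A (p∩q⊆q S S′) x∈)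
  open ≤-Reasoning
  upper : ∣ ⋃[ S ∪ S′ ] A ∣ ≤ ∣ S ∪ S′ ∣
  upper = +-cancelʳ-≤ ∣ S ∩ S′ ∣ _ _ (begin
    ∣ ⋃[ S ∪ S′ ] A ∣ + ∣ S ∩ S′ ∣
      ≤⟨ +-mono-≤ (p⊆q⇒∣p∣≤∣q∣ ⋃∪) (≤-trans (hc _ (S⊆ ∘ p∩q⊆p S S′)) (p⊆q⇒∣p∣≤∣q∣ ⋃∩)) ⟩
    ∣ ⋃[ S ] A ∪ ⋃[ S′ ] A ∣ + ∣ ⋃[ S ] A ∩ ⋃[ S′ ] A ∣
      ≡⟨ ∣p∪q∣+∣p∩q∣ (⋃[ S ] A) (⋃[ S′ ] A) ⟩
    ∣ ⋃[ S ] A ∣ + ∣ ⋃[ S′ ] A ∣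
      ≡⟨ cong₂ _+_ tS tS′ ⟩
    ∣ S ∣ + ∣ S′ ∣
      ≡⟨ ∣p∪q∣+∣p∩q∣ S S′ ⟨
    ∣ S ∪ S′ ∣ + ∣ S ∩ S′ ∣ ∎)

lookup-map- : (A : Vec (Subset m) n) (α : Fin m) (v : Fin n) → lookup (V.map (_- α) A) v ≡ lookup A v - α
lookup-map- (X ∷ A) α zero = refl
lookup-map- (X ∷ A) α (suc v) = lookup-map- A α v

⋃-map- : (S : Subset n) (A : Vec (Subset m) n) (α : Fin m) → ⋃[ S ] A - α ⊆ ⋃[ S ] V.map (_- α) A
⋃-map- S A α x∈ with x∈U , x≢ ← x∈p-y⁻ (⋃[ S ] A) x∈ with v , v∈ , h ← ∈⋃⁻ S A x∈U =
  ∈⋃⁺ S _ v∈ (subst (_ ∈_) (sym (lookup-map- A α v)) (x∈p∧x≢y⇒x∈p-y h x≢))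

-- A violator created by the deletion of α is tight before the deletion, and its lists contain α.
tight-violator : (A : Vec (Subset m) n) {H S : Subset n} (α : Fin m) → HallCondition A H → S ⊆ H →
                 ∣ ⋃[ S ] V.map (_- α) A ∣ < ∣ S ∣ → Tight A H S × α ∈ ⋃[ S ] A
tight-violator A {S = S} α hc S⊆H lt = (S⊆H , ≤-antisym (≤-trans (∣p∣≤1+∣p-x∣ (⋃[ S ] A) α) lt′) (hc S S⊆H)) , α∈
  where
  lt′ : ∣ ⋃[ S ] A - α ∣ < ∣ S ∣
  lt′ = ≤-<-trans (p⊆q⇒∣p∣≤∣q∣ (⋃-map- S A α)) lt
  α∈ : α ∈ ⋃[ S ] A
  α∈ with α ∈? ⋃[ S ] A
  ... | yes h = h
  ... | no h = contradiction (≤-<-trans (p⊆q⇒∣p∣≤∣q∣ {p = ⋃[ S ] A} {⋃[ S ] A - α} λ {x} x∈ → x∈p∧x≢y⇒x∈p-y x∈ λ { refl → h x∈ }) lt′)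
                             (≤⇒≯ (hc S S⊆H))

-- `tight-∪` merges the tight sets chosen for the single colours of `X`, starting from the empty
-- set, which is tight as well.
tight-cover : (A : Vec (Subset m) n) {H : Subset n} (X : Subset m) → HallCondition A H →
              (∀ {α} → α ∈ X → ∃ λ S → Tight A H S × α ∈ ⋃[ S ] A) →
              ∃ λ S → Tight A H S × X ⊆ ⋃[ S ] A
tight-cover {m} {n} A {H} X hc f = let S , tS , c = go (allFin m) in S , tS , λ {α} α∈ → c (∈-allFin α) α∈
  where
  ∅-tight : Tight A H ∅
  ∅-tight = ⊥⊆ , ≤-antisym (≤-reflexive (trans (cong ∣_∣ (Empty-unique empty)) (trans (∣⊥∣≡0 m) (sym (∣⊥∣≡0 n))))) (hc ∅ ⊥⊆)
    where
    empty : ¬ Nonempty (⋃[ ∅ ] A)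
    empty (x , x∈) with v , v∈ , _ ← ∈⋃⁻ ∅ A x∈ = ∉⊥ v∈
  go : (l : List (Fin m)) → ∃ λ S → Tight A H S × (∀ {α} → α LM.∈ l → α ∈ X → α ∈ ⋃[ S ] A)
  go [] = ∅ , ∅-tight , λ ()
  go (α ∷ l) with S , tS , c ← go l with α ∈? X
  ... | no α∉ = S , tS , λ where
    (hereᴸ refl) α∈ → contradiction α∈ α∉
    (thereᴸ i) → c i
  ... | yes α∈ with S′ , tS′ , α∈S′ ← f α∈ = S′ ∪ S , tight-∪ A hc tS′ tS , λ where
    (hereᴸ refl) _ → ⋃-mono {S = S′} A (p⊆p∪q S) α∈S′
    (thereᴸ i) h → ⋃-mono A (q⊆p∪q S′ S) (c i h)

-- Induction on the vertices. The head takes a colour whose deletion from the other lists keeps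
-- Hall's condition. If each colour of `X` destroys it, each lies in the colours of a tight set, so
-- one tight set covers `X`; adding the head to that set adds a vertex and no colour, against Hall's
-- condition. The argument `d` is only the value of `rep` outside `H`.
hall : Fin m → (A : Vec (Subset m) n) (H : Subset n) → HallCondition A H → SDR A H
hall d [] [] _ = sdr (λ ()) (λ ()) (λ ())
hall {m = m} d (X ∷ A) (false ∷ H) hc with sdr φ ∈A inj ← hall d A H (λ S S⊆H → hc (false ∷ S) (out⊆ S⊆H))
  = sdr (λ { zero → d ; (suc v) → φ v }) (λ { (there v∈) → ∈A v∈ })
        (λ { (there u∈) (there v∈) e → cong suc (inj u∈ v∈ e) })
hall {m = m} {suc n} d (X ∷ A) (true ∷ H) hc
  with FP.any? (λ α → (α ∈? X) ×-dec ¬? (anySubset? (λ S → (S ⊆? H) ×-dec (∣ ⋃[ S ] V.map (_- α) A ∣ <? ∣ S ∣))))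
... | yes (α , α∈X , ok)
  with sdr φ ∈A inj ← hall d (V.map (_- α) A) H (λ S S⊆H → ≮⇒≥ λ lt → ok (S , S⊆H , lt))
  = sdr ψ ψ∈ ψ-inj
  where
  ψ : Fin (suc n) → Fin m
  ψ zero = α
  ψ (suc v) = φ v
  φ∈ : ∀ {v} → v ∈ H → φ v ∈ lookup A v × φ v ≢ α
  φ∈ {v} v∈ = x∈p-y⁻ (lookup A v) (subst (φ v ∈_) (lookup-map- A α v) (∈A v∈))
  ψ∈ : ∀ {v} → v ∈ true ∷ H → ψ v ∈ lookup (X ∷ A) v
  ψ∈ here = α∈X
  ψ∈ (there v∈) = proj₁ (φ∈ v∈)
  ψ-inj : ∀ {u v} → u ∈ true ∷ H → v ∈ true ∷ H → ψ u ≡ ψ v → u ≡ v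
  ψ-inj here here _ = refl
  ψ-inj here (there v∈) e = contradiction (sym e) (proj₂ (φ∈ v∈))
  ψ-inj (there u∈) here e = contradiction e (proj₂ (φ∈ u∈))
  ψ-inj (there u∈) (there v∈) e = cong suc (inj u∈ v∈ e)
... | no none = let S , tS , X⊆ = tight-cover A X hcA tight in
                contradiction (hc (true ∷ S) (in⊆in (proj₁ tS))) (<⇒≱ (violates tS X⊆))
  where
  hcA : HallCondition A H
  hcA S S⊆H = hc (false ∷ S) (out⊆ S⊆H)
  tight : ∀ {α} → α ∈ X → ∃ λ S → Tight A H S × α ∈ ⋃[ S ] A
  tight {α} α∈ with anySubset? (λ S → (S ⊆? H) ×-dec (∣ ⋃[ S ] V.map (_- α) A ∣ <? ∣ S ∣))
  ... | yes (S , S⊆H , lt) = S , tight-violator A α hcA S⊆H lt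
  ... | no ok = contradiction (α , α∈ , ok) none
  violates : ∀ {S} → Tight A H S → X ⊆ ⋃[ S ] A → ∣ X ∪ ⋃[ S ] A ∣ < suc ∣ S ∣
  violates {S} (_ , t) X⊆ = s≤s (subst (∣ X ∪ ⋃[ S ] A ∣ ≤_) t (p⊆q⇒∣p∣≤∣q∣ λ x∈ → case-∪ (x∈p∪q⁻ X _ x∈)))
    where
    case-∪ : ∀ {x} → x ∈ X ⊎ x ∈ ⋃[ S ] A → x ∈ ⋃[ S ] A
    case-∪ (inj₁ h) = X⊆ h
    case-∪ (inj₂ h) = h

-- Enumeration of rooted trees, and the colours repeated along a tree.

elements : Subset n → List (Fin n)
elements [] = []
elements (true ∷ p) = zero ∷ map suc (elements p)
elements (false ∷ p) = map suc (elements p)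

length-elements : (p : Subset n) → length (elements p) ≡ ∣ p ∣
length-elements [] = refl
length-elements (true ∷ p) = cong suc (trans (length-map suc (elements p)) (length-elements p))
length-elements (false ∷ p) = trans (length-map suc (elements p)) (length-elements p)

∈-elements : (p : Subset n) {x : Fin n} → x ∈ p → x LM.∈ elements p
∈-elements (true ∷ p) here = hereᴸ refl
∈-elements (true ∷ p) (there x∈) = thereᴸ (∈-map⁺ suc (∈-elements p x∈))
∈-elements (false ∷ p) (there x∈) = ∈-map⁺ suc (∈-elements p x∈)

neighbours : Graph n → Fin n → List (Fin n)
neighbours G v = elements (V.tabulate (adj G v))

∈-neighbours : (G : Graph n) {u v : Fin n} → adj G v u ≡ true → u LM.∈ neighbours G v
∈-neighbours G {u} {v} e = ∈-elements (V.tabulate (adj G v)) (VP.lookup⇒[]= u _ (trans (VP.lookup∘tabulate (adj G v) u) e))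

length-neighbours : (G : Graph n) (v : Fin n) → length (neighbours G v) ≤ maxDegree G
length-neighbours G v = begin
  length (neighbours G v)               ≡⟨ length-elements (V.tabulate (adj G v)) ⟩
  degree G v                            ≡⟨ VP.lookup∘tabulate (degree G) v ⟨
  lookup (V.tabulate (degree G)) v      ≤⟨ lookup≤foldr-⊔ (V.tabulate (degree G)) v ⟩
  maxDegree G                           ∎
  where
  open ≤-Reasoning
  lookup≤foldr-⊔ : ∀ {n} (xs : Vec ℕ n) (i : Fin n) → lookup xs i ≤ V.foldr (λ _ → ℕ) _⊔_ 0 xs
  lookup≤foldr-⊔ (x ∷ xs) zero = m≤m⊔n x _
  lookup≤foldr-⊔ (x ∷ xs) (suc i) = ≤-trans (lookup≤foldr-⊔ xs i) (m≤n⊔m x _)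

-- A trail from the root v lists the vertices of a tree containing v, latest first, each
-- paired with its parent.
Trail : ℕ → Set
Trail n = List (Fin n × Fin n)

vertices : Fin n → Trail n → Subset n
vertices v [] = ⁅ v ⁆
vertices v ((u , p) ∷ t) = ⁅ u ⁆ ∪ vertices v t

Valid : Fin n → Trail n → Set
Valid v [] = U.⊤
Valid v ((u , p) ∷ t) = u ∉ vertices v t × p ∈ vertices v t × Valid v t

Linked : ListAssignment n m → Trail n → Set
Linked L [] = U.⊤
Linked L ((u , p) ∷ t) = Nonempty (lookup L u ∩ lookup L p) × Linked L t

seen : ListAssignment n m → Fin n → Trail n → Subset m
seen L v [] = lookup L v
seen L v ((u , p) ∷ t) = lookup L u ∪ seen L v t

repeats : ListAssignment n m → Fin n → Trail n → ℕ
repeats L v [] = 0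
repeats L v ((u , p) ∷ t) = ∣ lookup L u ∩ seen L v t ∣ + repeats L v t

Bad : ℕ → ListAssignment n m → Fin n → Trail n → Set
Bad k L v t = Valid v t × Linked L t × k * (k ∸ 1) + length t ≤ repeats L v t

valid? : (v : Fin n) (t : Trail n) → Dec (Valid v t)
valid? v [] = yes U.tt
valid? v ((u , p) ∷ t) = ¬? (u ∈? _) ×-dec ((p ∈? _) ×-dec valid? v t)

linked? : (L : ListAssignment n m) (t : Trail n) → Dec (Linked L t)
linked? L [] = yes U.tt
linked? L ((u , p) ∷ t) = nonempty? _ ×-dec linked? L t

bad? : ∀ k (L : ListAssignment n m) v t → Dec (Bad k L v t)
bad? k L v t = valid? v t ×-dec (linked? L t ×-dec (_ ≤? _))

-- Runs through at most N candidate edges and keeps exactly j of them as tree edges; every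
-- kept edge makes the edges at its new vertex candidates.
grow : Graph n → (N j : ℕ) (candidates : List (Fin n × Fin n)) → Trail n → List (Trail n)
grow G N zero es t = t ∷ []
grow G zero (suc j) es t = []
grow G (suc N) (suc j) [] t = []
grow G (suc N) (suc j) ((u , p) ∷ es) t =
  grow G N (suc j) es t ++ grow G N j (map (_, u) (neighbours G u) ++ es) ((u , p) ∷ t)

-- The budget suffices for every tree: each of its `l + 1` vertices makes at most `maxDegree G`
-- edges candidates.
trails : Graph n → ℕ → Fin n → List (Trail n)
trails G l v = grow G (maxDegree G * suc l) l (map (_, v) (neighbours G v)) []

-- Skipping and keeping the next candidate are the two terms of Pascal's rule. A tree is thus
-- encoded by which of the inspected edges it keeps.
length-grow : (G : Graph n) → ∀ N j es t → length (grow G N j es t) ≤ N C j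
length-grow G N zero es t = ≤-refl
length-grow G zero (suc j) es t = z≤n
length-grow G (suc N) (suc j) [] t = z≤n
length-grow G (suc N) (suc j) ((u , p) ∷ es) t = begin
  length (grow G N (suc j) es t ++ grow G N j es′ t′)          ≡⟨ length-++ (grow G N (suc j) es t) ⟩
  length (grow G N (suc j) es t) + length (grow G N j es′ t′)  ≤⟨ +-mono-≤ (length-grow G N (suc j) es t) (length-grow G N j es′ t′) ⟩
  N C suc j + N C j                                            ≡⟨ +-comm (N C suc j) (N C j) ⟩
  N C j + N C suc j                                            ≡⟨ nCk+nC[k+1]≡[n+1]C[k+1] N j ⟩
  suc N C suc j                                                ∎
  where
  open ≤-Reasoning
  es′ = map (_, u) (neighbours G u) ++ es
  t′ = (u , p) ∷ t

length-trails : (G : Graph n) → ∀ l v → length (trails G l v) ≤ (maxDegree G * suc l) C l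
length-trails G l v = length-grow G _ l _ []

grow-length : (G : Graph n) → ∀ N j es t {t′} → t′ LM.∈ grow G N j es t → length t′ ≡ j + length t
grow-length G N zero es t (hereᴸ refl) = refl
grow-length G (suc N) (suc j) ((u , p) ∷ es) t t′∈ with ∈-++⁻ (grow G N (suc j) es t) t′∈
... | inj₁ h = grow-length G N (suc j) es t h
... | inj₂ h = trans (grow-length G N j _ _ h) (+-suc j _)

∣⁅x⁆∪p∣ : (p : Subset n) {x : Fin n} → x ∉ p → ∣ ⁅ x ⁆ ∪ p ∣ ≡ suc ∣ p ∣
∣⁅x⁆∪p∣ {n} p {x} x∉p = +-cancelʳ-≡ ∣ ⁅ x ⁆ ∩ p ∣ _ _ (begin
  ∣ ⁅ x ⁆ ∪ p ∣ + ∣ ⁅ x ⁆ ∩ p ∣  ≡⟨ ∣p∪q∣+∣p∩q∣ ⁅ x ⁆ p ⟩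
  ∣ ⁅ x ⁆ ∣ + ∣ p ∣              ≡⟨ cong (_+ ∣ p ∣) (∣⁅x⁆∣≡1 x) ⟩
  suc ∣ p ∣                      ≡⟨ +-identityʳ _ ⟨
  suc ∣ p ∣ + 0                  ≡⟨ cong (suc ∣ p ∣ +_) (trans (cong ∣_∣ (Empty-unique disjoint)) (∣⊥∣≡0 n)) ⟨
  suc ∣ p ∣ + ∣ ⁅ x ⁆ ∩ p ∣      ∎)
  where
  open ≡-Reasoning
  disjoint : ¬ Nonempty (⁅ x ⁆ ∩ p)
  disjoint (y , y∈) with y∈x , y∈p ← x∈p∩q⁻ ⁅ x ⁆ p y∈ = x∉p (subst (_∈ p) (x∈⁅y⁆⇒x≡y x y∈x) y∈p)

∣vertices∣ : (v : Fin n) (t : Trail n) → Valid v t → ∣ vertices v t ∣ ≡ suc (length t)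
∣vertices∣ v [] _ = ∣⁅x⁆∣≡1 v
∣vertices∣ v ((u , p) ∷ t) (u∉ , _ , ok) = trans (∣⁅x⁆∪p∣ _ u∉) (cong suc (∣vertices∣ v t ok))

v∈vertices : (v : Fin n) (t : Trail n) → v ∈ vertices v t
v∈vertices v [] = x∈⁅x⁆ v
v∈vertices v ((u , _) ∷ t) = q⊆p∪q ⁅ u ⁆ _ (v∈vertices v t)

seen⊆⋃ : (L : ListAssignment n m) (v : Fin n) (t : Trail n) → seen L v t ⊆ ⋃[ vertices v t ] L
seen⊆⋃ L v [] x∈ = ∈⋃⁺ _ L (x∈⁅x⁆ v) x∈
seen⊆⋃ L v ((u , p) ∷ t) x∈ with x∈p∪q⁻ (lookup L u) _ x∈
... | inj₁ h = ∈⋃⁺ _ L (p⊆p∪q _ (x∈⁅x⁆ u)) h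
... | inj₂ h = ⋃-mono L (q⊆p∪q ⁅ u ⁆ _) (seen⊆⋃ L v t h)

-- Inclusion-exclusion for each added list. This exchange rate turns a shortage of colours into an
-- abundance of repetitions.
seen+repeats : ∀ {k} (L : ListAssignment n m) → IsKLists k L → (v : Fin n) (t : Trail n) →
               ∣ seen L v t ∣ + repeats L v t ≡ k * suc (length t)
seen+repeats {k = k} L kL v [] = trans (+-identityʳ _) (trans (kL v) (sym (*-identityʳ k)))
seen+repeats {k = k} L kL v ((u , p) ∷ t) = begin
  ∣ X ∪ S ∣ + (∣ X ∩ S ∣ + repeats L v t)  ≡⟨ +-assoc (∣ X ∪ S ∣) _ _ ⟨
  ∣ X ∪ S ∣ + ∣ X ∩ S ∣ + repeats L v t    ≡⟨ cong (_+ repeats L v t) (∣p∪q∣+∣p∩q∣ X S) ⟩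
  ∣ X ∣ + ∣ S ∣ + repeats L v t            ≡⟨ +-assoc (∣ X ∣) _ _ ⟩
  ∣ X ∣ + (∣ S ∣ + repeats L v t)          ≡⟨ cong₂ _+_ (kL u) (seen+repeats L kL v t) ⟩
  k + k * suc (length t)                   ≡⟨ *-suc k (suc (length t)) ⟨
  k * suc (suc (length t))                 ∎
  where
  open ≡-Reasoning
  X = lookup L u
  S = seen L v t

-- Conflict-connected sets: a proper colouring or a bad trail.

module _ (G : Graph n) (L : ListAssignment n m) where

  Conflict : Fin n → Fin n → Set
  Conflict x y = adj G x y ≡ true × Nonempty (lookup L x ∩ lookup L y)

  Crossing : Subset n → Subset n → Set
  Crossing H A = ∃ λ x → ∃ λ y → x ∈ A × y ∈ H × y ∉ A × Conflict x y

  conflict? : ∀ x y → Dec (Conflict x y)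
  conflict? x y = (adj G x y BP.≟ true) ×-dec nonempty? _

  crossing? : ∀ H A → Dec (Crossing H A)
  crossing? H A = FP.any? λ x → FP.any? λ y → (x ∈? A) ×-dec ((y ∈? H) ×-dec (¬? (y ∈? A) ×-dec conflict? x y))

  -- Connectivity is phrased by cuts rather than paths: an edge leaving a partial set is what
  -- growing a tree needs, and a failure is a cut along which colourings can be glued.
  Connected : Subset n → Set
  Connected H = ∀ A → A ⊆ H → Nonempty A → ∣ A ∣ < ∣ H ∣ → Crossing H A

  Spans : Subset n → Fin n → Trail n → Set
  Spans H v t = Valid v t × Linked L t × vertices v t ⊆ H × ∣ H ∣ ≡ ∣ vertices v t ∣

  -- The invariant is that all conflict edges from the tree to the rest of `H` are queued, and that
  -- the budget covers the queue plus `maxDegree G` candidates for each of the `j` vertices still to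
  -- come. Connectivity then shows that the queue cannot run out early.
  grow-spans : ∀ {H} → Connected H → ∀ {v} N j es t →
    Valid v t → Linked L t → vertices v t ⊆ H → ∣ H ∣ ≡ j + ∣ vertices v t ∣ →
    (∀ {x y} → x ∈ vertices v t → y ∈ H → y ∉ vertices v t → Conflict x y → (y , x) LM.∈ es) →
    length es + maxDegree G * j ≤ N →
    ∃ λ t′ → t′ LM.∈ grow G N j es t × Spans H v t′
  grow-spans conn N zero es t ok lk ⊆H size cand _ = t , hereᴸ refl , ok , lk , ⊆H , size
  grow-spans {H} conn {v} N (suc j) es t ok lk ⊆H size cand big
    with x , y , x∈ , y∈ , y∉ , xy ← conn (vertices v t) ⊆H (v , v∈vertices v t) (subst (_ <_) (sym size) (s≤s (m≤n+m _ j)))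
    with N | es | cand | big | cand x∈ y∈ y∉ xy
  ... | zero | _ ∷ _ | _ | () | _
  ... | suc N | (u , p) ∷ es | cand | s≤s big | _ 
    -- The branch of `grow` to follow: keep the candidate exactly when it is a conflict edge from
    -- the tree to a new vertex of `H`.
    with (u ∈? H) ×-dec (¬? (u ∈? vertices v t) ×-dec ((p ∈? vertices v t) ×-dec conflict? p u))
  ... | yes (u∈ , u∉ , p∈ , e , z , z∈)
    = let zp , zu = x∈p∩q⁻ (lookup L p) _ z∈
          t′ , t′∈ , sp = grow-spans conn N j (map (_, u) (neighbours G u) ++ es) ((u , p) ∷ t)
                            (u∉ , p∈ , ok) ((z , x∈p∩q⁺ (zu , zp)) , lk) ⊆H′ size′ cand′ big′
      in t′ , ∈-++⁺ʳ (grow G N (suc j) es t) t′∈ , sp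
    where
    ⊆H′ : ⁅ u ⁆ ∪ vertices v t ⊆ H
    ⊆H′ w∈ with x∈p∪q⁻ ⁅ u ⁆ _ w∈
    ... | inj₁ h = subst (_∈ H) (sym (x∈⁅y⁆⇒x≡y u h)) u∈
    ... | inj₂ h = ⊆H h
    size′ : ∣ H ∣ ≡ j + ∣ ⁅ u ⁆ ∪ vertices v t ∣
    size′ = trans size (trans (sym (+-suc j _)) (cong (j +_) (sym (∣⁅x⁆∪p∣ _ u∉))))
    cand′ : ∀ {x y} → x ∈ ⁅ u ⁆ ∪ vertices v t → y ∈ H → y ∉ ⁅ u ⁆ ∪ vertices v t → Conflict x y →
            (y , x) LM.∈ map (_, u) (neighbours G u) ++ es
    cand′ x∈ y∈ y∉ xy with x∈p∪q⁻ ⁅ u ⁆ _ x∈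
    ... | inj₁ h with refl ← x∈⁅y⁆⇒x≡y u h = ∈-++⁺ˡ (∈-map⁺ (_, u) (∈-neighbours G (proj₁ xy)))
    ... | inj₂ h with cand h y∈ (y∉ ∘ q⊆p∪q ⁅ u ⁆ _) xy
    ... | hereᴸ refl = contradiction (p⊆p∪q _ (x∈⁅x⁆ u)) y∉
    ... | thereᴸ i = ∈-++⁺ʳ _ i
    open ≤-Reasoning
    big′ : length (map (_, u) (neighbours G u) ++ es) + maxDegree G * j ≤ N
    big′ = begin
      length (map (_, u) (neighbours G u) ++ es) + maxDegree G * j
        ≡⟨ cong (_+ maxDegree G * j) (trans (length-++ (map (_, u) (neighbours G u))) (cong (_+ length es) (length-map _ (neighbours G u)))) ⟩
      length (neighbours G u) + length es + maxDegree G * j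
        ≤⟨ +-monoˡ-≤ (maxDegree G * j) (+-monoˡ-≤ (length es) (length-neighbours G u)) ⟩
      maxDegree G + length es + maxDegree G * j
        ≡⟨ rearrange (maxDegree G) (length es) j ⟩
      length es + maxDegree G * suc j
        ≤⟨ big ⟩
      N ∎
      where
      rearrange : ∀ d e j → d + e + d * j ≡ e + d * suc j
      rearrange = solve-∀
  ... | no skip
    = let t′ , t′∈ , sp = grow-spans conn N (suc j) es t ok lk ⊆H size cand′ big
      in t′ , ∈-++⁺ˡ t′∈ , sp
    where
    cand′ : ∀ {x y} → x ∈ vertices v t → y ∈ H → y ∉ vertices v t → Conflict x y → (y , x) LM.∈ es
    cand′ x∈ y∈ y∉ xy with cand x∈ y∈ y∉ xy
    ... | hereᴸ refl = contradiction (y∈ , y∉ , x∈ , xy) skip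
    ... | thereᴸ i = i

  -- The colour `z` shared along the conflict edge is already present, so `y` brings at most `k - 1`
  -- new ones.
  ∣⋃∪⁅⁆∣ : ∀ {k} → IsKLists k L → ∀ A {x y} → x ∈ A → Conflict x y →
           suc ∣ ⋃[ ⁅ y ⁆ ∪ A ] L ∣ ≤ ∣ ⋃[ A ] L ∣ + k
  ∣⋃∪⁅⁆∣ {k} kL A {x} {y} x∈ (_ , z , z∈) = begin
    suc ∣ ⋃[ ⁅ y ⁆ ∪ A ] L ∣            ≤⟨ s≤s (p⊆q⇒∣p∣≤∣q∣ sub) ⟩
    suc ∣ Y ∪ U′ ∣                      ≡⟨ +-comm 1 _ ⟩
    ∣ Y ∪ U′ ∣ + 1                      ≡⟨ cong (∣ Y ∪ U′ ∣ +_) (∣⁅x⁆∣≡1 z) ⟨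
    ∣ Y ∪ U′ ∣ + ∣ ⁅ z ⁆ ∣              ≤⟨ +-monoʳ-≤ ∣ Y ∪ U′ ∣ (p⊆q⇒∣p∣≤∣q∣ λ w∈ → subst (_∈ Y ∩ U′) (sym (x∈⁅y⁆⇒x≡y z w∈)) z∈Y∩U) ⟩
    ∣ Y ∪ U′ ∣ + ∣ Y ∩ U′ ∣             ≡⟨ ∣p∪q∣+∣p∩q∣ Y U′ ⟩
    ∣ Y ∣ + ∣ U′ ∣                      ≡⟨ trans (cong (_+ ∣ U′ ∣) (kL y)) (+-comm k _) ⟩
    ∣ U′ ∣ + k                          ∎
    where
    open ≤-Reasoning
    Y = lookup L y
    U′ = ⋃[ A ] L
    z∈Y∩U : z ∈ Y ∩ U′
    z∈Y∩U with zx , zy ← x∈p∩q⁻ (lookup L x) _ z∈ = x∈p∩q⁺ (zy , ∈⋃⁺ A L x∈ zx)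
    sub : ⋃[ ⁅ y ⁆ ∪ A ] L ⊆ Y ∪ U′
    sub w∈ with v , v∈ , h ← ∈⋃⁻ (⁅ y ⁆ ∪ A) L w∈ with x∈p∪q⁻ ⁅ y ⁆ A v∈
    ... | inj₁ v∈y with refl ← x∈⁅y⁆⇒x≡y y v∈y = x∈p∪q⁺ (inj₁ h)
    ... | inj₂ v∈A = x∈p∪q⁺ (inj₂ (∈⋃⁺ A L v∈A h))

  -- Induction on the number `d` of vertices of `H` outside `A`. A vertex added along a conflict
  -- edge raises `h * ∣ A ∣` by `h` and the number of colours by at most `h`, so the slack `c`
  -- survives.
  few-colours : ∀ h → IsKLists (suc h) L → ∀ {H} → Connected H → ∀ c d A → A ⊆ H → Nonempty A →
                d + ∣ A ∣ ≡ ∣ H ∣ → ∣ ⋃[ A ] L ∣ + c ≤ h * ∣ A ∣ → ∣ ⋃[ H ] L ∣ + c ≤ h * ∣ H ∣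
  few-colours h kL {H} conn c zero A A⊆H _ size bound = begin
    ∣ ⋃[ H ] L ∣ + c   ≤⟨ +-monoˡ-≤ c (p⊆q⇒∣p∣≤∣q∣ (⋃-mono {S = H} L (p⊆q∧∣q∣≤∣p∣⇒q⊆p A⊆H (≤-reflexive (sym size))))) ⟩
    ∣ ⋃[ A ] L ∣ + c   ≤⟨ bound ⟩
    h * ∣ A ∣          ≡⟨ cong (h *_) size ⟩
    h * ∣ H ∣          ∎
    where open ≤-Reasoning
  few-colours h kL {H} conn c (suc d) A A⊆H ne size bound
    with x , y , x∈ , y∈ , y∉ , xy ← conn A A⊆H ne (subst (∣ A ∣ <_) size (s≤s (m≤n+m _ d)))
    = few-colours h kL conn c d (⁅ y ⁆ ∪ A) sub (y , p⊆p∪q A (x∈⁅x⁆ y))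
        (trans (cong (d +_) (∣⁅x⁆∪p∣ A y∉)) (trans (+-suc d _) size))
        (≤-pred (begin
          suc ∣ ⋃[ ⁅ y ⁆ ∪ A ] L ∣ + c   ≤⟨ +-monoˡ-≤ c (∣⋃∪⁅⁆∣ kL A x∈ xy) ⟩
          ∣ ⋃[ A ] L ∣ + suc h + c       ≡⟨ rearrange (∣ ⋃[ A ] L ∣) h c ⟩
          suc (∣ ⋃[ A ] L ∣ + c + h)     ≤⟨ s≤s (+-monoˡ-≤ h bound) ⟩
          suc (h * ∣ A ∣ + h)            ≡⟨ cong suc (trans (+-comm _ h) (sym (*-suc h _))) ⟩
          suc (h * suc ∣ A ∣)            ≡⟨ cong (λ s → suc (h * s)) (∣⁅x⁆∪p∣ A y∉) ⟨
          suc (h * ∣ ⁅ y ⁆ ∪ A ∣)        ∎))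
    where
    open ≤-Reasoning
    rearrange : ∀ a h c → a + suc h + c ≡ suc (a + c + h)
    rearrange = solve-∀
    sub : ⁅ y ⁆ ∪ A ⊆ H
    sub w∈ with x∈p∪q⁻ ⁅ y ⁆ A w∈
    ... | inj₁ i = subst (_∈ H) (sym (x∈⁅y⁆⇒x≡y y i)) y∈
    ... | inj₂ i = A⊆H i

  ColourableOn : Subset n → Set
  ColourableOn H = Σ (Fin n → Fin m) λ c →
    (∀ {v} → v ∈ H → c v ∈ lookup L v) ×
    (∀ {u v} → u ∈ H → v ∈ H → adj G u v ≡ true → c u ≢ c v)

  BadTrail : ℕ → Set
  BadTrail k = ∃ λ l → ∃ λ v → ∃ λ t → k ≤ l × l < n × t LM.∈ trails G l v × Bad k L v t

  sdr-colours : ∀ {H} → SDR L H → ColourableOn H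
  sdr-colours (sdr φ φ∈ inj) = φ , φ∈ , λ {u} u∈ v∈ uv e →
    case-refl (inj u∈ v∈ e) uv
    where
    case-refl : ∀ {u v} → u ≡ v → adj G u v ≢ true
    case-refl {u} refl uu with () ← trans (sym uu) (irref G u)

  -- An edge across the cut whose ends received the same colour would have this colour in both
  -- lists, hence be a conflict.
  combine : ∀ {H A} → A ⊆ H → ¬ Crossing H A → ColourableOn A → ColourableOn (H ─ A) → ColourableOn H
  combine {H} {A} A⊆H none (c , c∈ , c-ok) (d , d∈ , d-ok) = e , (λ {v} → e∈ v) , λ {u} {v} → e-ok u v
    where
    e : Fin n → Fin m
    e v with v ∈? A
    ... | yes _ = c v
    ... | no _ = d v
    e∈ : ∀ v → v ∈ H → e v ∈ lookup L v
    e∈ v v∈ with v ∈? A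
    ... | yes h = c∈ h
    ... | no h = d∈ (x∈p∧x∉q⇒x∈p─q v∈ h)
    e-ok : ∀ u v → u ∈ H → v ∈ H → adj G u v ≡ true → e u ≢ e v
    e-ok u v u∈ v∈ uv with u ∈? A | v ∈? A
    ... | yes a | yes b = c-ok a b uv
    ... | no a | no b = d-ok (x∈p∧x∉q⇒x∈p─q u∈ a) (x∈p∧x∉q⇒x∈p─q v∈ b) uv
    ... | yes a | no b = λ eq → none (u , v , a , v∈ , b , uv , c u ,
      x∈p∩q⁺ (c∈ a , subst (_∈ lookup L v) (sym eq) (d∈ (x∈p∧x∉q⇒x∈p─q v∈ b))))
    ... | no a | yes b = λ eq → none (v , u , b , u∈ , a , trans (Graph.sym G v u) uv , c v ,
      x∈p∩q⁺ (c∈ b , subst (_∈ lookup L u) eq (d∈ (x∈p∧x∉q⇒x∈p─q u∈ a))))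

  -- The violator `S` need not be connected itself. Its shortage of colours is therefore carried
  -- over to the connected set `H`, and the trail spans `H`.
  violator-trail : ∀ h → IsKLists (2 + h) L → ∀ {H} → Connected H → ∀ {S} → S ⊆ H →
                   ∣ ⋃[ S ] L ∣ < ∣ S ∣ → BadTrail (2 + h)
  violator-trail h kL {H} conn {S} S⊆H few = from-nonempty (nonempty? S)
    where
    open ≤-Reasoning
    k = 2 + h
    from-nonempty : Dec (Nonempty S) → BadTrail k
    from-nonempty (no empty) =
      contradiction (subst (∣ ⋃[ S ] L ∣ <_) (trans (cong ∣_∣ (Empty-unique empty)) (∣⊥∣≡0 n)) few) n≮0
    from-nonempty (yes (v , v∈)) = l , v , t , ≤-trans k<s′ ≤-refl , l<n , t∈ , ok , lk , many
      where
      s = ∣ H ∣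
      l = s ∸ 1
      -- The list of the single vertex `v` already contributes `k` colours.
      k<∣S∣ : k < ∣ S ∣
      k<∣S∣ = ≤-<-trans (subst (_≤ ∣ ⋃[ S ] L ∣) (kL v) (p⊆q⇒∣p∣≤∣q∣ (∈⋃⁺ S L v∈))) few
      k<s : k < s
      k<s = ≤-trans k<∣S∣ (p⊆q⇒∣p∣≤∣q∣ S⊆H)
      s≡ : s ≡ suc l
      s≡ = sym (m+[n∸m]≡n (≤-trans (s≤s z≤n) k<s))
      k<s′ : k ≤ l
      k<s′ = ≤-pred (subst (k <_) s≡ k<s)
      l<n : l < n
      l<n = subst (_≤ n) s≡ (∣p∣≤n H)
      -- This is `k(k-1) - 1`. As `∣S∣ ≥ k + 1` and the union has at most `∣S∣ - 1` colours,
      -- `(k-1)∣S∣` exceeds it by at least `(k-2)(k+1) + 1 = c`.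
      c = 1 + 3 * h + h * h
      base : ∣ ⋃[ S ] L ∣ + c ≤ suc h * ∣ S ∣
      base = begin
        ∣ ⋃[ S ] L ∣ + c                        ≡⟨ lhs (∣ ⋃[ S ] L ∣) h ⟩
        suc ∣ ⋃[ S ] L ∣ + h * (3 + h)          ≤⟨ +-mono-≤ few (*-monoʳ-≤ h k<∣S∣) ⟩
        suc h * ∣ S ∣                           ∎
        where
        lhs : ∀ a h → a + (1 + 3 * h + h * h) ≡ suc a + h * (3 + h)
        lhs = solve-∀
      final : ∣ ⋃[ H ] L ∣ + c ≤ suc h * s
      final = few-colours (suc h) kL conn c (s ∸ ∣ S ∣) S S⊆H (v , v∈) (m∸n+n≡m (p⊆q⇒∣p∣≤∣q∣ S⊆H)) base
      spanning = grow-spans conn {v} (maxDegree G * suc l) l (map (_, v) (neighbours G v)) [] U.tt U.tt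
        (λ w∈ → subst (_∈ H) (sym (x∈⁅y⁆⇒x≡y v w∈)) (S⊆H v∈))
        (trans s≡ (trans (+-comm 1 l) (cong (l +_) (sym (∣⁅x⁆∣≡1 v)))))
        (λ x∈ y∈ _ xy → from-root (x∈⁅y⁆⇒x≡y v x∈) xy)
        (begin
          length (map (_, v) (neighbours G v)) + maxDegree G * l  ≡⟨ cong (_+ maxDegree G * l) (length-map _ (neighbours G v)) ⟩
          length (neighbours G v) + maxDegree G * l               ≤⟨ +-monoˡ-≤ _ (length-neighbours G v) ⟩
          maxDegree G + maxDegree G * l                           ≡⟨ *-suc (maxDegree G) l ⟨
          maxDegree G * suc l                                     ∎)
        where
        from-root : ∀ {x y} → x ≡ v → Conflict x y → (y , x) LM.∈ map (_, v) (neighbours G v)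
        from-root refl xy = ∈-map⁺ (_, v) (∈-neighbours G (proj₁ xy))
      t = proj₁ spanning
      t∈ = proj₁ (proj₂ spanning)
      ok = proj₁ (proj₂ (proj₂ spanning))
      lk = proj₁ (proj₂ (proj₂ (proj₂ spanning)))
      ⊆H = proj₁ (proj₂ (proj₂ (proj₂ (proj₂ spanning))))
      size = proj₂ (proj₂ (proj₂ (proj₂ (proj₂ spanning))))
      s≡len : s ≡ suc (length t)
      s≡len = trans size (∣vertices∣ v t ok)
      σ = ∣ seen L v t ∣
      -- The seen colours number at most `(k-1)s - c`, so of the `ks` list entries at least
      -- `s + c = k(k-1) + length t` are repetitions. Adding `σ + suc h * s` to both sides avoids
      -- subtraction.
      many : k * (k ∸ 1) + length t ≤ repeats L v t
      many = +-cancelˡ-≤ (σ + suc h * s) _ _ (begin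
        σ + suc h * s + (k * suc h + length t)
          ≡⟨ rearrange σ (suc h * s) h (length t) ⟩
        σ + c + (suc h * s + suc (length t))
          ≤⟨ +-monoˡ-≤ _ (+-monoˡ-≤ c (p⊆q⇒∣p∣≤∣q∣ λ x∈ → ⋃-mono L ⊆H (seen⊆⋃ L v t x∈))) ⟩
        ∣ ⋃[ H ] L ∣ + c + (suc h * s + suc (length t))
          ≤⟨ +-monoˡ-≤ _ final ⟩
        suc h * s + (suc h * s + suc (length t))
          ≡⟨ cong (λ x → suc h * s + (suc h * s + x)) s≡len ⟨
        suc h * s + (suc h * s + s)
          ≡⟨ cong (suc h * s +_) (+-comm (suc h * s) s) ⟩
        suc h * s + k * s
          ≡⟨ cong (λ x → suc h * s + k * x) s≡len ⟩
        suc h * s + k * suc (length t)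
          ≡⟨ cong (suc h * s +_) (seen+repeats L kL v t) ⟨
        suc h * s + (σ + repeats L v t)
          ≡⟨ trans (sym (+-assoc (suc h * s) σ _)) (cong (_+ repeats L v t) (+-comm (suc h * s) σ)) ⟩
        σ + suc h * s + repeats L v t ∎)
        where
        rearrange : ∀ σ a h l → σ + a + ((2 + h) * suc h + l) ≡ σ + (1 + 3 * h + h * h) + (a + suc l)
        rearrange = solve-∀

  -- A conflict-free cut is sought before Hall's condition is tested, so that violators are met only
  -- inside connected sets. Both sides of a cut are smaller than `H`, since `A` is nonempty and
  -- proper.
  colour-or-bad : ∀ h → IsKLists (2 + h) L → Fin m → ∀ H → Acc _<_ ∣ H ∣ → ColourableOn H ⊎ BadTrail (2 + h)
  colour-or-bad h kL d H (acc rec)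
    with anySubset? (λ A → (A ⊆? H) ×-dec (nonempty? A ×-dec ((∣ A ∣ <? ∣ H ∣) ×-dec ¬? (crossing? H A))))
  ... | yes (A , A⊆H , (a , a∈) , A<H , none)
    with colour-or-bad h kL d A (rec A<H)
       | colour-or-bad h kL d (H ─ A) (rec (p∩q≢∅⇒∣p─q∣<∣p∣ H A (a , x∈p∩q⁺ (A⊆H a∈ , a∈))))
  ... | inj₂ bad | _ = inj₂ bad
  ... | inj₁ _ | inj₂ bad = inj₂ bad
  ... | inj₁ c | inj₁ e = inj₁ (combine A⊆H none c e)
  colour-or-bad h kL d H (acc rec) | no connected with hall? L H
  ... | inj₁ hc = inj₁ (sdr-colours (hall d L H hc))
  ... | inj₂ (S , S⊆H , few) = inj₂ (violator-trail h kL conn S⊆H few)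
    where
    conn : Connected H
    conn A A⊆H ne lt with crossing? H A
    ... | yes cr = cr
    ... | no none = contradiction (A , (λ {x} → A⊆H {x}) , ne , lt , none) connected

  colourable-or-bad : ∀ h → IsKLists (2 + h) L → Fin m → Colourable G L ⊎ BadTrail (2 + h)
  colourable-or-bad h kL d with colour-or-bad h kL d full (<-wellFounded _)
  ... | inj₁ (c , c∈ , ok) = inj₁ (c , (λ v → c∈ ∈⊤) , λ u v → ok ∈⊤ ∈⊤)
  ... | inj₂ bad = inj₂ bad

-- Finite sums and indicators.

∑ : List A → (A → ℕ) → ℕ
∑ [] f = 0
∑ (x ∷ xs) f = f x + ∑ xs f

∑-cong : (xs : List A) {f g : A → ℕ} → (∀ x → f x ≡ g x) → ∑ xs f ≡ ∑ xs g
∑-cong [] e = refl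
∑-cong (x ∷ xs) e = cong₂ _+_ (e x) (∑-cong xs e)

∑-mono : (xs : List A) {f g : A → ℕ} → (∀ {x} → x LM.∈ xs → f x ≤ g x) → ∑ xs f ≤ ∑ xs g
∑-mono [] h = z≤n
∑-mono (x ∷ xs) h = +-mono-≤ (h (hereᴸ refl)) (∑-mono xs (h ∘ thereᴸ))

∑-++ : (xs ys : List A) (f : A → ℕ) → ∑ (xs ++ ys) f ≡ ∑ xs f + ∑ ys f
∑-++ [] ys f = refl
∑-++ (x ∷ xs) ys f = trans (cong (f x +_) (∑-++ xs ys f)) (sym (+-assoc (f x) _ _))

∑-map : (g : A → B) (xs : List A) (f : B → ℕ) → ∑ (map g xs) f ≡ ∑ xs (f ∘ g)
∑-map g [] f = refl
∑-map g (x ∷ xs) f = cong (f (g x) +_) (∑-map g xs f)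

∑-* : (c : ℕ) (xs : List A) (f : A → ℕ) → ∑ xs (λ x → c * f x) ≡ c * ∑ xs f
∑-* c [] f = sym (*-zeroʳ c)
∑-* c (x ∷ xs) f = trans (cong (c * f x +_) (∑-* c xs f)) (sym (*-distribˡ-+ c (f x) _))

∑-const : (c : ℕ) (xs : List A) → ∑ xs (λ _ → c) ≡ length xs * c
∑-const c [] = refl
∑-const c (x ∷ xs) = cong (c +_) (∑-const c xs)

∑-+ : (xs : List A) (f g : A → ℕ) → ∑ xs (λ x → f x + g x) ≡ ∑ xs f + ∑ xs g
∑-+ [] f g = refl
∑-+ (x ∷ xs) f g = trans (cong (f x + g x +_) (∑-+ xs f g)) (swap (f x) (g x) _ _)
  where
  swap : ∀ a b c d → a + b + (c + d) ≡ a + c + (b + d)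
  swap = solve-∀

∑-swap : (xs : List A) (ys : List B) (f : A → B → ℕ) →
         ∑ xs (λ x → ∑ ys (f x)) ≡ ∑ ys (λ y → ∑ xs (λ x → f x y))
∑-swap [] ys f = sym (trans (∑-const 0 ys) (*-zeroʳ (length ys)))
∑-swap (x ∷ xs) ys f = trans (cong (∑ ys (f x) +_) (∑-swap xs ys f)) (sym (∑-+ ys (f x) _))

∑-cartesianProductWith : ∀ {C : Set} (g : A → B → C) (xs : List A) (ys : List B) (f : C → ℕ) →
  ∑ (cartesianProductWith g xs ys) f ≡ ∑ xs (λ x → ∑ ys (λ y → f (g x y)))
∑-cartesianProductWith g [] ys f = refl
∑-cartesianProductWith g (x ∷ xs) ys f =
  trans (∑-++ (map (g x) ys) _ f) (cong₂ _+_ (∑-map (g x) ys f) (∑-cartesianProductWith g xs ys f))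

∑-∈ : (xs : List A) (f : A → ℕ) {x : A} → x LM.∈ xs → f x ≤ ∑ xs f
∑-∈ (x ∷ xs) f (hereᴸ refl) = m≤m+n (f x) _
∑-∈ (x ∷ xs) f (thereᴸ i) = ≤-trans (∑-∈ xs f i) (m≤n+m _ (f x))

ι : Dec A → ℕ
ι (yes _) = 1
ι (no _) = 0

ι-yes : (d : Dec A) → A → ι d ≡ 1
ι-yes (yes _) _ = refl
ι-yes (no ¬a) a = contradiction a ¬a

ι-no : (d : Dec A) → ¬ A → ι d ≡ 0
ι-no (yes a) ¬a = contradiction a ¬a
ι-no (no _) _ = refl

ι-cong : (d : Dec A) (e : Dec B) → (A → B) → (B → A) → ι d ≡ ι e
ι-cong (yes a) e f g = sym (ι-yes e (f a))
ι-cong (no ¬a) e f g = sym (ι-no e (¬a ∘ g))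

length-filter : ∀ {P : A → Set} (P? : ∀ x → Dec (P x)) (xs : List A) → length (filter P? xs) ≡ ∑ xs (ι ∘ P?)
length-filter P? [] = refl
length-filter P? (x ∷ xs) with P? x
... | yes _ = cong suc (length-filter P? xs)
... | no _ = length-filter P? xs

-- Binomial coefficients and the generating function of weighted subsets.

[1+n]*nCk : ∀ n k → suc n * (n C k) ≡ suc k * (suc n C suc k)
[1+n]*nCk zero zero = refl
[1+n]*nCk zero (suc k) = sym (*-zeroʳ k)
[1+n]*nCk (suc n) zero = begin
  suc (suc n) * (suc n C 0)                    ≡⟨ *-identityʳ (suc (suc n)) ⟩
  suc (suc n)                                  ≡⟨ cong suc (trans (sym (*-identityʳ (suc n))) (trans ([1+n]*nCk n 0) (*-identityˡ _))) ⟩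
  suc n C 0 + suc n C 1                        ≡⟨ nCk+nC[k+1]≡[n+1]C[k+1] (suc n) 0 ⟩
  suc (suc n) C 1                              ≡⟨ *-identityˡ (suc (suc n) C 1) ⟨
  1 * (suc (suc n) C 1)                        ∎
  where open ≡-Reasoning
[1+n]*nCk (suc n) (suc k) = begin
  suc (suc n) * c₁                                      ≡⟨ cong (λ c → c₁ + suc n * c) (sym (nCk+nC[k+1]≡[n+1]C[k+1] n k)) ⟩
  c₁ + suc n * (n C k + n C suc k)                      ≡⟨ cong (c₁ +_) (*-distribˡ-+ (suc n) (n C k) _) ⟩
  c₁ + (suc n * (n C k) + suc n * (n C suc k))          ≡⟨ cong (c₁ +_) (cong₂ _+_ ([1+n]*nCk n k) ([1+n]*nCk n (suc k))) ⟩
  c₁ + (suc k * c₁ + suc (suc k) * c₂)                  ≡⟨ rearrange c₁ c₂ k ⟩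
  suc (suc k) * (c₁ + c₂)                               ≡⟨ cong (suc (suc k) *_) (nCk+nC[k+1]≡[n+1]C[k+1] (suc n) (suc k)) ⟩
  suc (suc k) * (suc (suc n) C suc (suc k))             ∎
  where
  open ≡-Reasoning
  c₁ = suc n C suc k
  c₂ = suc n C suc (suc k)
  rearrange : ∀ a b k → a + (suc k * a + suc (suc k) * b) ≡ suc (suc k) * (a + b)
  rearrange = solve-∀

nCk>0 : ∀ n k → k ≤ n → 1 ≤ n C k
nCk>0 n zero _ = ≤-refl
nCk>0 (suc n) (suc k) (s≤s k≤n) =
  subst (1 ≤_) (nCk+nC[k+1]≡[n+1]C[k+1] n k) (≤-trans (nCk>0 n k k≤n) (m≤m+n _ _))

-- The coefficient of tʲ in (1 + Yt)^σ (1 + t)^ρ.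
coeff : (Y σ ρ j : ℕ) → ℕ
coeff Y zero ρ j = ρ C j
coeff Y (suc σ) ρ zero = 1
coeff Y (suc σ) ρ (suc j) = coeff Y σ ρ (suc j) + Y * coeff Y σ ρ j

coeff-0 : ∀ Y σ ρ → coeff Y σ ρ 0 ≡ 1
coeff-0 Y zero ρ = refl
coeff-0 Y (suc σ) ρ = refl

coeff-suc : ∀ Y σ ρ j → coeff Y σ (suc ρ) (suc j) ≡ coeff Y σ ρ (suc j) + coeff Y σ ρ j
coeff-suc Y zero ρ j = trans (sym (nCk+nC[k+1]≡[n+1]C[k+1] ρ j)) (+-comm (ρ C j) _)
coeff-suc Y (suc σ) ρ zero =
  trans (cong₂ (λ a b → a + Y * b) (coeff-suc Y σ ρ 0) (trans (coeff-0 Y σ (suc ρ)) (sym (coeff-0 Y σ ρ))))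
        (trans (cong (λ z → coeff Y σ ρ 1 + z + Y * coeff Y σ ρ 0) (coeff-0 Y σ ρ)) (rearrange (coeff Y σ ρ 1) _))
  where
  rearrange : ∀ a b → a + 1 + b ≡ a + b + 1
  rearrange = solve-∀
coeff-suc Y (suc σ) ρ (suc j) =
  trans (cong₂ (λ a b → a + Y * b) (coeff-suc Y σ ρ (suc j)) (coeff-suc Y σ ρ j))
        (rearrange (coeff Y σ ρ (suc (suc j))) (coeff Y σ ρ (suc j)) (coeff Y σ ρ j) Y)
  where
  rearrange : ∀ a b c y → a + b + y * (b + c) ≡ a + y * b + (b + y * c)
  rearrange = solve-∀

-- (1 + Yt)^(σ+1) (1 + t)^ρ = (1 + Yt)^σ (1 + t)^(ρ+1) + Zt (1 + Yt)^σ (1 + t)^ρ for Y = 1 + Z.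
coeff-split : ∀ Z σ ρ j → coeff (suc Z) (suc σ) ρ (suc j) ≡ coeff (suc Z) σ (suc ρ) (suc j) + Z * coeff (suc Z) σ ρ j
coeff-split Z σ ρ j = trans (sym (+-assoc (coeff (suc Z) σ ρ (suc j)) _ _)) (cong (_+ Z * coeff (suc Z) σ ρ j) (sym (coeff-suc (suc Z) σ ρ j)))

-- The factors `1 + Yt` are exchanged for `1 + t` one at a time by `coeff-split`. With `M` factors
-- in total and target degree `j`, an exchange costs `Z` times the binomial coefficient of `M - 1`
-- over `j - 1`, which is `Zj/M` times that of `M` over `j`. By hypothesis each exchange thus costs
-- at most a factor `1 + 1/(Q+1)`.
coeff-bound : ∀ Z Q σ ρ j → Z * j * suc Q ≤ σ + ρ →
              coeff (suc Z) σ ρ j * suc Q ^ σ ≤ ((σ + ρ) C j) * (2 + Q) ^ σ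
coeff-bound Z Q zero ρ j _ = ≤-refl
coeff-bound Z Q (suc σ) ρ zero _ =
  *-monoʳ-≤ 1 (^-monoˡ-≤ (suc σ) (n≤1+n (suc Q)))
coeff-bound Z Q (suc σ) ρ (suc j) small = begin
  coeff (suc Z) (suc σ) ρ (suc j) * (suc Q * q)    ≡⟨ cong (_* (suc Q * q)) (coeff-split Z σ ρ j) ⟩
  (c₁ + Z * c₂) * (suc Q * q)                       ≡⟨ expand c₁ c₂ Z (suc Q) q ⟩
  suc Q * (c₁ * q) + Z * suc Q * (c₂ * q)           ≤⟨ +-mono-≤ (*-monoʳ-≤ (suc Q) ih₁) (*-monoʳ-≤ (Z * suc Q) (coeff-bound Z Q σ ρ j (shrink Z (σ + ρ) small))) ⟩
  suc Q * (b * q′) + Z * suc Q * (((σ + ρ) C j) * q′) ≡⟨ collect (suc Q) b q′ Z ((σ + ρ) C j) ⟩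
  (suc Q * b + Z * suc Q * ((σ + ρ) C j)) * q′      ≤⟨ *-monoˡ-≤ q′ (+-monoʳ-≤ (suc Q * b) ratio) ⟩
  (suc Q * b + b) * q′                              ≡⟨ finish Q b q′ ⟩
  b * ((2 + Q) * q′)                                ∎
  where
  open ≤-Reasoning
  c₁ = coeff (suc Z) σ (suc ρ) (suc j)
  c₂ = coeff (suc Z) σ ρ j
  q = suc Q ^ σ
  q′ = (2 + Q) ^ σ
  b = suc (σ + ρ) C suc j
  ih₁ : c₁ * q ≤ b * q′
  ih₁ = subst (λ M → c₁ * q ≤ (M C suc j) * q′) (+-suc σ ρ)
          (coeff-bound Z Q σ (suc ρ) (suc j) (subst (Z * suc j * suc Q ≤_) (sym (+-suc σ ρ)) small))
  shrink : ∀ Z M → Z * suc j * suc Q ≤ suc M → Z * j * suc Q ≤ M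
  shrink zero M _ = z≤n
  shrink (suc Z) M h = ≤-pred (≤-trans (≤-trans (m≤m+n _ (Q + Z * suc Q)) (≤-reflexive (regroup Z j Q))) h)
    where
    regroup : ∀ Z j Q → suc (suc Z * j * suc Q) + (Q + Z * suc Q) ≡ suc Z * suc j * suc Q
    regroup = solve-∀
  expand : ∀ a b z q p → (a + z * b) * (q * p) ≡ q * (a * p) + z * q * (b * p)
  expand = solve-∀
  collect : ∀ q b p z c → q * (b * p) + z * q * (c * p) ≡ (q * b + z * q * c) * p
  collect = solve-∀
  finish : ∀ q b p → (suc q * b + b) * p ≡ b * ((2 + q) * p)
  finish = solve-∀
  ratio : Z * suc Q * ((σ + ρ) C j) ≤ b
  ratio = *-cancelˡ-≤ (suc (σ + ρ)) (begin
    suc (σ + ρ) * (Z * suc Q * ((σ + ρ) C j))     ≡⟨ swap (suc (σ + ρ)) (Z * suc Q) _ ⟩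
    Z * suc Q * (suc (σ + ρ) * ((σ + ρ) C j))     ≡⟨ cong (Z * suc Q *_) ([1+n]*nCk (σ + ρ) j) ⟩
    Z * suc Q * (suc j * b)                       ≡⟨ swap′ Z (suc Q) (suc j) b ⟩
    Z * suc j * suc Q * b                         ≤⟨ *-monoˡ-≤ b small ⟩
    suc (σ + ρ) * b                               ∎)
    where
    swap : ∀ a b c → a * (b * c) ≡ b * (a * c)
    swap = solve-∀
    swap′ : ∀ a b c d → a * b * (c * d) ≡ a * c * b * d
    swap′ = solve-∀

-- Bernoulli's inequality (1 - 1/(Q+1))ᴺ ≥ d/(Q+1) for d = Q + 1 - N.
bernoulli : ∀ Q N d → N + d ≡ suc Q → suc Q ^ N * d ≤ Q ^ N * suc Q
bernoulli Q zero d e = *-monoʳ-≤ 1 (≤-reflexive e)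
bernoulli Q (suc N) d e = begin
  suc Q * p * d            ≡⟨ swap (suc Q) p d ⟩
  p * (suc Q * d)          ≤⟨ *-monoʳ-≤ p (+-monoˡ-≤ (Q * d) (subst (d ≤_) (suc-injective e) (m≤n+m d N))) ⟩
  p * (Q + Q * d)          ≡⟨ swap₂ p Q d ⟩
  Q * (p * suc d)          ≤⟨ *-monoʳ-≤ Q (bernoulli Q N (suc d) (trans (+-suc N d) e)) ⟩
  Q * (Q ^ N * suc Q)      ≡⟨ *-assoc Q _ _ ⟨
  Q * Q ^ N * suc Q        ∎
  where
  open ≤-Reasoning
  p = suc Q ^ N
  swap : ∀ a b c → a * b * c ≡ b * (a * c)
  swap = solve-∀
  swap₂ : ∀ p q d → p * (q + q * d) ≡ q * (p * suc d)
  swap₂ = solve-∀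

-- Bernoulli's inequality with `Q = 71c` bounds the quotient of the powers by `(71c+1)/(70c+1)`,
-- which is less than 71/70.
bernoulli-71 : ∀ c N → N ≤ c → suc (71 * c) ^ N * 70 ≤ 71 * (71 * c) ^ N
bernoulli-71 c N N≤c = *-cancelʳ-≤ _ _ (suc (71 * c)) (begin
  p * 70 * suc (71 * c)              ≤⟨ m≤m+n _ p ⟩
  p * 70 * suc (71 * c) + p          ≡⟨ regroup p c ⟩
  71 * (p * suc (70 * c))            ≤⟨ *-monoʳ-≤ 71 (*-monoʳ-≤ p (m≤n+m _ (c ∸ N))) ⟩
  71 * (p * (c ∸ N + suc (70 * c)))  ≤⟨ *-monoʳ-≤ 71 (bernoulli (71 * c) N _ split) ⟩
  71 * ((71 * c) ^ N * suc (71 * c)) ≡⟨ *-assoc 71 ((71 * c) ^ N) _ ⟨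
  71 * (71 * c) ^ N * suc (71 * c)   ∎)
  where
  open ≤-Reasoning
  p = suc (71 * c) ^ N
  regroup : ∀ p c → p * 70 * suc (71 * c) + p ≡ 71 * (p * suc (70 * c))
  regroup = solve-∀
  split : N + (c ∸ N + suc (70 * c)) ≡ suc (71 * c)
  split = trans (sym (+-assoc N _ _)) (trans (cong (_+ suc (70 * c)) (m+[n∸m]≡n N≤c)) (+-suc c (70 * c)))

-- Weighted sums over the possible lists of one vertex.

kSubsets : ∀ m → ℕ → List (Subset m)
kSubsets zero zero = [] ∷ []
kSubsets zero (suc k) = []
kSubsets (suc m) zero = map (false ∷_) (kSubsets m zero)
kSubsets (suc m) (suc k) = map (true ∷_) (kSubsets m k) ++ map (false ∷_) (kSubsets m (suc k))

length-kSubsets : ∀ m k → length (kSubsets m k) ≡ m C k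
length-kSubsets zero zero = refl
length-kSubsets zero (suc k) = refl
length-kSubsets (suc m) zero = trans (length-map _ (kSubsets m zero)) (length-kSubsets m zero)
length-kSubsets (suc m) (suc k) = begin
  length (map (true ∷_) (kSubsets m k) ++ map (false ∷_) (kSubsets m (suc k)))  ≡⟨ length-++ (map (true ∷_) (kSubsets m k)) ⟩
  _ ≡⟨ cong₂ _+_ (trans (length-map _ (kSubsets m k)) (length-kSubsets m k)) (trans (length-map _ (kSubsets m (suc k))) (length-kSubsets m (suc k))) ⟩
  m C k + m C suc k   ≡⟨ nCk+nC[k+1]≡[n+1]C[k+1] m k ⟩
  suc m C suc k       ∎
  where open ≡-Reasoning

∈-kSubsets : (X : Subset m) → X LM.∈ kSubsets m ∣ X ∣
∈-kSubsets [] = hereᴸ refl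
∈-kSubsets (true ∷ X) = ∈-++⁺ˡ (∈-map⁺ (true ∷_) (∈-kSubsets X))
∈-kSubsets (false ∷ X) with ∣ X ∣ | ∈-kSubsets X
... | zero | i = ∈-map⁺ (false ∷_) i
... | suc k | i = ∈-++⁺ʳ (map (true ∷_) (kSubsets _ k)) (∈-map⁺ (false ∷_) i)

kSubsets-size : ∀ m k {X} → X LM.∈ kSubsets m k → ∣ X ∣ ≡ k
kSubsets-size zero zero (hereᴸ refl) = refl
kSubsets-size (suc m) zero X∈ with _ , i , refl ← ∈-map⁻ (false ∷_) X∈ = kSubsets-size m zero i
kSubsets-size (suc m) (suc k) X∈ with ∈-++⁻ (map (true ∷_) (kSubsets m k)) X∈
... | inj₁ h with _ , i , refl ← ∈-map⁻ (true ∷_) h = cong suc (kSubsets-size m k i)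
... | inj₂ h with _ , i , refl ← ∈-map⁻ (false ∷_) h = kSubsets-size m (suc k) i

kSubsets-unique : ∀ m k → Unique (kSubsets m k)
kSubsets-unique zero zero = All.[] AP.∷ AP.[]
kSubsets-unique zero (suc k) = AP.[]
kSubsets-unique (suc m) zero = UP.map⁺ VP.∷-injectiveʳ (kSubsets-unique m zero)
kSubsets-unique (suc m) (suc k) =
  UP.++⁺ (UP.map⁺ VP.∷-injectiveʳ (kSubsets-unique m k)) (UP.map⁺ VP.∷-injectiveʳ (kSubsets-unique m (suc k))) disjoint
  where
  disjoint : ∀ {X} → ¬ (X LM.∈ map (true ∷_) (kSubsets m k) × X LM.∈ map (false ∷_) (kSubsets m (suc k)))
  disjoint (i , j) with ∈-map⁻ (true ∷_) i | ∈-map⁻ (false ∷_) j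
  ... | _ , _ , refl | _ , _ , ()

∑-kSubsets-suc : ∀ m k (f : Subset (suc m) → ℕ) →
  ∑ (kSubsets (suc m) (suc k)) f ≡ ∑ (kSubsets m k) (f ∘ (true ∷_)) + ∑ (kSubsets m (suc k)) (f ∘ (false ∷_))
∑-kSubsets-suc m k f = trans (∑-++ (map (true ∷_) (kSubsets m k)) _ f)
  (cong₂ _+_ (∑-map (true ∷_) (kSubsets m k) f) (∑-map (false ∷_) (kSubsets m (suc k)) f))

-- Each colour of `S` offers the factor `1 + Yt`, each other colour `1 + t`; the exponent of `t`
-- counts the colours chosen.
∑-Y^∩ : ∀ Y j (S : Subset m) → ∑ (kSubsets m j) (λ X → Y ^ ∣ X ∩ S ∣) ≡ coeff Y (∣ S ∣) (∣ ∁ S ∣) j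
∑-Y^∩ Y zero [] = refl
∑-Y^∩ Y (suc j) [] = refl
∑-Y^∩ {suc m} Y zero (b ∷ S) = trans (∑-map (false ∷_) (kSubsets m zero) _) (trans (∑-Y^∩ Y zero S) (trans (coeff-0 Y (∣ S ∣) _) (sym (coeff-0 Y (∣ b ∷ S ∣) _))))
∑-Y^∩ {suc m} Y (suc j) (true ∷ S) = begin
  ∑ (kSubsets (suc m) (suc j)) _   ≡⟨ ∑-kSubsets-suc m j _ ⟩
  ∑ (kSubsets m j) (λ X → Y * Y ^ ∣ X ∩ S ∣) + ∑ (kSubsets m (suc j)) (λ X → Y ^ ∣ X ∩ S ∣)
    ≡⟨ cong₂ _+_ (trans (∑-* Y (kSubsets m j) _) (cong (Y *_) (∑-Y^∩ Y j S))) (∑-Y^∩ Y (suc j) S) ⟩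
  Y * coeff Y (∣ S ∣) _ j + coeff Y (∣ S ∣) _ (suc j)   ≡⟨ +-comm (Y * coeff Y (∣ S ∣) _ j) _ ⟩
  coeff Y (∣ S ∣) _ (suc j) + Y * coeff Y (∣ S ∣) _ j   ∎
  where open ≡-Reasoning
∑-Y^∩ {suc m} Y (suc j) (false ∷ S) = begin
  ∑ (kSubsets (suc m) (suc j)) _   ≡⟨ ∑-kSubsets-suc m j _ ⟩
  ∑ (kSubsets m j) (λ X → Y ^ ∣ X ∩ S ∣) + ∑ (kSubsets m (suc j)) (λ X → Y ^ ∣ X ∩ S ∣)
    ≡⟨ cong₂ _+_ (∑-Y^∩ Y j S) (∑-Y^∩ Y (suc j) S) ⟩
  coeff Y (∣ S ∣) _ j + coeff Y (∣ S ∣) _ (suc j)   ≡⟨ +-comm (coeff Y (∣ S ∣) _ j) _ ⟩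
  coeff Y (∣ S ∣) _ (suc j) + coeff Y (∣ S ∣) _ j   ≡⟨ coeff-suc Y (∣ S ∣) _ j ⟨
  coeff Y (∣ S ∣) (suc _) (suc j)   ∎
  where open ≡-Reasoning

-- Fixing `a` in `X` yields one factor `Y`; the other `j` colours are free, and `σ` colours of `S`
-- remain to be hit.
∑-∋-Y^∩ : ∀ Y j (S : Subset (suc m)) {a σ} → a ∈ S → ∣ S ∣ ≡ suc σ →
  ∑ (kSubsets (suc m) (suc j)) (λ X → ι (a ∈? X) * Y ^ ∣ X ∩ S ∣) ≡ Y * coeff Y σ (∣ ∁ S ∣) j
∑-∋-Y^∩ {m} Y j (true ∷ S) here refl = begin
  ∑ (kSubsets (suc m) (suc j)) _   ≡⟨ ∑-kSubsets-suc m j _ ⟩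
  ∑ (kSubsets m j) (λ X → 1 * (Y * Y ^ ∣ X ∩ S ∣)) + ∑ (kSubsets m (suc j)) (λ X → 0)
    ≡⟨ cong₂ _+_ (∑-cong (kSubsets m j) (λ X → *-identityˡ _)) (trans (∑-const 0 (kSubsets m (suc j))) (*-zeroʳ (length (kSubsets m (suc j))))) ⟩
  ∑ (kSubsets m j) (λ X → Y * Y ^ ∣ X ∩ S ∣) + 0     ≡⟨ +-identityʳ _ ⟩
  ∑ (kSubsets m j) (λ X → Y * Y ^ ∣ X ∩ S ∣)         ≡⟨ ∑-* Y (kSubsets m j) _ ⟩
  Y * ∑ (kSubsets m j) (λ X → Y ^ ∣ X ∩ S ∣)         ≡⟨ cong (Y *_) (∑-Y^∩ Y j S) ⟩
  Y * coeff Y (∣ S ∣) _ j                              ∎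
  where open ≡-Reasoning
∑-∋-Y^∩ {suc m} Y j (b ∷ S) {suc a} (there a∈) e = trans (∑-kSubsets-suc (suc m) j _) (step b j e)
  where
  open ≡-Reasoning
  ι-there : ∀ {b} (X : Subset (suc m)) → ι (suc a ∈? b ∷ X) ≡ ι (a ∈? X)
  ι-there X = ι-cong (suc a ∈? _) (a ∈? X) (λ { (there h) → h }) there
  f : ∀ b → Subset (suc (suc m)) → ℕ
  f b X = ι (suc a ∈? X) * Y ^ ∣ X ∩ (b ∷ S) ∣
  tail : ∀ b j {σ} → ∣ S ∣ ≡ suc σ → ∑ (kSubsets (suc m) (suc j)) (f b ∘ (false ∷_)) ≡ Y * coeff Y σ (∣ ∁ S ∣) j
  tail b j e = trans (∑-cong (kSubsets (suc m) (suc j)) λ X → cong (_* Y ^ ∣ X ∩ S ∣) (ι-there X)) (∑-∋-Y^∩ Y j S a∈ e)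
  head : ∀ b j → (c : ℕ) → (∀ X → f b (true ∷ X) ≡ c * (ι (a ∈? X) * Y ^ ∣ X ∩ S ∣)) → ∀ {σ} → ∣ S ∣ ≡ suc σ →
         ∑ (kSubsets (suc m) (suc j)) (f b ∘ (true ∷_)) ≡ c * (Y * coeff Y σ (∣ ∁ S ∣) j)
  head b j c h e = trans (∑-cong (kSubsets (suc m) (suc j)) h) (trans (∑-* c (kSubsets (suc m) (suc j)) _) (cong (c *_) (∑-∋-Y^∩ Y j S a∈ e)))
  swap : ∀ a b c → a * (b * c) ≡ b * (a * c)
  swap = solve-∀
  true-true : ∀ X → f true (true ∷ X) ≡ Y * (ι (a ∈? X) * Y ^ ∣ X ∩ S ∣)
  true-true X = trans (cong (_* (Y * Y ^ ∣ X ∩ S ∣)) (ι-there X)) (swap (ι (a ∈? X)) Y _)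
  true-false : ∀ X → f false (true ∷ X) ≡ 1 * (ι (a ∈? X) * Y ^ ∣ X ∩ S ∣)
  true-false X = trans (cong (_* (Y ^ ∣ X ∩ S ∣)) (ι-there X)) (sym (*-identityˡ _))
  none : ∀ b → ∑ (kSubsets (suc m) 0) (f b ∘ (true ∷_)) ≡ 0
  none b = ≤-antisym (≤-trans (∑-mono (kSubsets (suc m) 0) {g = λ _ → 0} λ {X} X∈ →
      ≤-reflexive (cong (_* _) (ι-no (suc a ∈? true ∷ X) λ { (there h) → n≮0 (subst (_ ≤_) (kSubsets-size (suc m) 0 X∈) (∣⁅x⁆∣≤ X h)) })))
      (≤-reflexive (trans (∑-const 0 (kSubsets (suc m) 0)) (*-zeroʳ (length (kSubsets (suc m) 0)))))) z≤n
    where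
    ∣⁅x⁆∣≤ : (X : Subset (suc m)) → a ∈ X → 1 ≤ ∣ X ∣
    ∣⁅x⁆∣≤ X h = subst (_≤ ∣ X ∣) (∣⁅x⁆∣≡1 a) (p⊆q⇒∣p∣≤∣q∣ λ y∈ → subst (_∈ X) (sym (x∈⁅y⁆⇒x≡y a y∈)) h)
  ∣S∣>0 : ∃ λ τ → ∣ S ∣ ≡ suc τ
  ∣S∣>0 with ∣ S ∣ | x∈p⇒∣p-x∣<∣p∣ a∈
  ... | suc τ | _ = τ , refl
  step : ∀ b j {σ} → ∣ b ∷ S ∣ ≡ suc σ →
    ∑ (kSubsets (suc m) j) (f b ∘ (true ∷_)) + ∑ (kSubsets (suc m) (suc j)) (f b ∘ (false ∷_))
      ≡ Y * coeff Y σ (∣ ∁ (b ∷ S) ∣) j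
  step true zero {σ} e with τ , e′ ← ∣S∣>0 = trans (cong₂ _+_ (none true) (tail true 0 e′))
    (cong (Y *_) (trans (coeff-0 Y τ _) (sym (coeff-0 Y σ _))))
  step false zero {σ} e = trans (cong₂ _+_ (none false) (tail false 0 e))
    (cong (Y *_) (trans (coeff-0 Y σ _) (sym (coeff-0 Y σ _))))
  step true (suc j) {σ} e with τ , e′ ← ∣S∣>0 with refl ← trans (sym (suc-injective e)) e′ =
    trans (cong₂ _+_ (head true j Y true-true e′) (tail true (suc j) e′))
          (trans (+-comm (Y * (Y * coeff Y τ _ j)) _) (sym (*-distribˡ-+ Y (coeff Y τ _ (suc j)) _)))
  step false (suc j) {σ} e =
    trans (cong₂ _+_ (trans (head false j 1 true-false e) (*-identityˡ _)) (tail false (suc j) e))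
          (trans (+-comm (Y * coeff Y σ _ j) _) (trans (sym (*-distribˡ-+ Y (coeff Y σ _ (suc j)) _)) (cong (Y *_) (sym (coeff-suc Y σ _ j)))))

ι-meets : (X P : Subset m) → ι (nonempty? (X ∩ P)) ≤ ∑ (elements P) (λ a → ι (a ∈? X))
ι-meets X P with nonempty? (X ∩ P)
... | no _ = z≤n
... | yes (a , a∈) with aX , aP ← x∈p∩q⁻ X P a∈ =
  subst (_≤ ∑ (elements P) (λ a → ι (a ∈? X))) (ι-yes (a ∈? X) aX) (∑-∈ (elements P) (λ a → ι (a ∈? X)) (∈-elements P aP))

elements-∈ : (p : Subset n) {x : Fin n} → x LM.∈ elements p → x ∈ p
elements-∈ (true ∷ p) (hereᴸ refl) = here
elements-∈ (true ∷ p) (thereᴸ i) with _ , j , refl ← ∈-map⁻ suc i = there (elements-∈ p j)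
elements-∈ (false ∷ p) i with _ , j , refl ← ∈-map⁻ suc i = there (elements-∈ p j)

-- Divided by `m C k`, this is the expected factor that a new tree vertex brings to the weight,
-- where `P` is its parent's list and `S` the set of colours seen so far.
hits : (Y k : ℕ) (P S : Subset m) → ℕ
hits Y k P S = ∑ (kSubsets _ k) (λ X → ι (nonempty? (X ∩ P)) * Y ^ ∣ X ∩ S ∣)

-- With `Q + 1 = 71c` each of the at most `c` exchanges in `coeff-bound` costs `1 + 1/(71c)`, and
-- all together cost at most 71/70.
coeff-71 : ∀ Z c M σ j → 0 < c → σ ≤ c → σ ≤ M → Z * j * (71 * c) ≤ M →
           70 * coeff (suc Z) σ (M ∸ σ) j ≤ 71 * (M C j)
coeff-71 Z (suc c) M σ j _ σ≤c σ≤M small = *-cancelʳ-≤ _ _ (q ^ σ) {{m^n≢0 q σ}} (begin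
  70 * e * q ^ σ                 ≡⟨ *-assoc 70 e _ ⟩
  70 * (e * q ^ σ)               ≤⟨ *-monoʳ-≤ 70 bound ⟩
  70 * ((M C j) * suc q ^ σ)     ≡⟨ rearrange (M C j) (suc q ^ σ) ⟩
  (M C j) * (suc q ^ σ * 70)     ≤⟨ *-monoʳ-≤ (M C j) (bernoulli-71 (suc c) σ σ≤c) ⟩
  (M C j) * (71 * q ^ σ)         ≡⟨ rearrange′ (M C j) (q ^ σ) ⟩
  71 * (M C j) * q ^ σ           ∎)
  where
  open ≤-Reasoning
  q = 71 * suc c
  e = coeff (suc Z) σ (M ∸ σ) j
  M≡ : σ + (M ∸ σ) ≡ M
  M≡ = m+[n∸m]≡n σ≤M
  bound : e * q ^ σ ≤ (M C j) * suc q ^ σ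
  bound = subst (λ N → e * q ^ σ ≤ (N C j) * suc q ^ σ) M≡
    (coeff-bound Z (pred q) σ (M ∸ σ) j (subst (Z * j * q ≤_) (sym M≡) small))
  rearrange : ∀ a b → 70 * (a * b) ≡ a * (b * 70)
  rearrange = solve-∀
  rearrange′ : ∀ a b → a * (71 * b) ≡ 71 * a * b
  rearrange′ = solve-∀

-- Union bound over the common colour `a` of `X` and `P`: there are `k` choices, each in `X` with
-- probability `k/m`. As `P ⊆ S`, the colour `a` accounts for the factor `Y`, and the other colours
-- of `X` for 71/70.
hits-bound : ∀ Z k c (P S : Subset m) → P ⊆ S → ∣ P ∣ ≡ k → ∣ S ∣ ≤ c → Z * k * (71 * c) ≤ m →
             70 * m * hits (suc Z) k P S ≤ 71 * (k * k) * suc Z * (m C k)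
hits-bound {m} Z zero c P S P⊆S ∣P∣ σ≤c small = subst (_≤ 71 * 0 * suc Z * (m C 0)) (sym (trans (cong (70 * m *_) hits≡0) (*-zeroʳ (70 * m)))) z≤n
  where
  hits≡0 : hits (suc Z) zero P S ≡ 0
  hits≡0 = trans (∑-cong (kSubsets _ 0) λ X → cong (_* _) (ι-no (nonempty? (X ∩ P))
      λ (a , a∈) → n≮0 (subst (∣ P - a ∣ <_) ∣P∣ (x∈p⇒∣p-x∣<∣p∣ (proj₂ (x∈p∩q⁻ X P a∈))))))
    (trans (∑-const 0 (kSubsets m 0)) (*-zeroʳ (length (kSubsets m 0))))
hits-bound {zero} Z (suc k) c P S P⊆S ∣P∣ σ≤c small = z≤n
hits-bound {suc m} Z (suc k) c P S P⊆S ∣P∣ σ≤c small = begin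
  70 * suc m * hits Y (suc k) P S                            ≤⟨ *-monoʳ-≤ (70 * suc m) pointwise ⟩
  70 * suc m * (suc k * (Y * e))                             ≡⟨ rearrange₁ (suc m) (suc k) Y e ⟩
  suc k * Y * suc m * (70 * e)                               ≤⟨ *-monoʳ-≤ (suc k * Y * suc m) (coeff-71 Z c m σ k 0<c (≤-trans (n≤1+n σ) (subst (_≤ c) S≡ σ≤c)) σ≤m small′) ⟩
  suc k * Y * suc m * (71 * (m C k))                         ≡⟨ rearrange₂ (suc k) Y (suc m) (m C k) ⟩
  71 * suc k * Y * (suc m * (m C k))                         ≡⟨ cong (71 * suc k * Y *_) ([1+n]*nCk m k) ⟩
  71 * suc k * Y * (suc k * (suc m C suc k))                 ≡⟨ rearrange₃ (suc k) Y (suc m C suc k) ⟩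
  71 * (suc k * suc k) * Y * (suc m C suc k)                 ∎
  where
  open ≤-Reasoning
  Y = suc Z
  σ = ∣ S ∣ ∸ 1
  S≡ : ∣ S ∣ ≡ suc σ
  S≡ = sym (m+[n∸m]≡n (≤-trans (subst (1 ≤_) (sym ∣P∣) (s≤s z≤n)) (p⊆q⇒∣p∣≤∣q∣ P⊆S)))
  0<c : 0 < c
  0<c = ≤-trans (subst (1 ≤_) (sym S≡) (s≤s z≤n)) σ≤c
  σ≤m : σ ≤ m
  σ≤m = ≤-pred (subst (_≤ suc m) S≡ (∣p∣≤n S))
  e = coeff Y σ (m ∸ σ) k
  ∁S : ∣ ∁ S ∣ ≡ m ∸ σ
  ∁S = trans (∣∁p∣≡n∸∣p∣ S) (cong (suc m ∸_) S≡)
  small′ : Z * k * (71 * c) ≤ m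
  small′ = shrink Z c 0<c small
    where
    shrink : ∀ Z c → 0 < c → Z * suc k * (71 * c) ≤ suc m → Z * k * (71 * c) ≤ m
    shrink zero c _ _ = z≤n
    shrink (suc Z) (suc c) _ h = ≤-pred (≤-trans (≤-trans (m≤m+n _ (70 + 71 * c + Z * (71 * suc c))) (≤-reflexive (regroup Z k c))) h)
      where
      regroup : ∀ Z k c → suc (suc Z * k * (71 * suc c)) + (70 + 71 * c + Z * (71 * suc c)) ≡ suc Z * suc k * (71 * suc c)
      regroup = solve-∀
  pointwise : hits Y (suc k) P S ≤ suc k * (Y * e)
  pointwise = begin
    hits Y (suc k) P S
      ≤⟨ ∑-mono (kSubsets (suc m) (suc k)) (λ {X} _ → ≤-trans (*-monoˡ-≤ (Y ^ ∣ X ∩ S ∣) (ι-meets X P)) (≤-reflexive (expand X))) ⟩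
    ∑ (kSubsets (suc m) (suc k)) (λ X → ∑ (elements P) (λ a → ι (a ∈? X) * Y ^ ∣ X ∩ S ∣))
      ≡⟨ ∑-swap (kSubsets (suc m) (suc k)) (elements P) _ ⟩
    ∑ (elements P) (λ a → ∑ (kSubsets (suc m) (suc k)) (λ X → ι (a ∈? X) * Y ^ ∣ X ∩ S ∣))
      ≤⟨ ∑-mono (elements P) (λ a∈ → ≤-reflexive (trans (∑-∋-Y^∩ Y k S (P⊆S (elements-∈ P a∈)) S≡) (cong (λ ρ → Y * coeff Y σ ρ k) ∁S))) ⟩
    ∑ (elements P) (λ _ → Y * e)
      ≡⟨ trans (∑-const (Y * e) (elements P)) (cong (_* (Y * e)) (trans (length-elements P) ∣P∣)) ⟩
    suc k * (Y * e) ∎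
    where
    expand : ∀ X → ∑ (elements P) (λ a → ι (a ∈? X)) * Y ^ ∣ X ∩ S ∣ ≡ ∑ (elements P) (λ a → ι (a ∈? X) * Y ^ ∣ X ∩ S ∣)
    expand X = trans (*-comm _ (Y ^ ∣ X ∩ S ∣)) (trans (sym (∑-* (Y ^ ∣ X ∩ S ∣) (elements P) _))
      (∑-cong (elements P) λ a → *-comm (Y ^ ∣ X ∩ S ∣) (ι (a ∈? X))))
  rearrange₁ : ∀ M k y e → 70 * M * (k * (y * e)) ≡ k * y * M * (70 * e)
  rearrange₁ = solve-∀
  rearrange₂ : ∀ k y M c → k * y * M * (71 * c) ≡ 71 * k * y * (M * c)
  rearrange₂ = solve-∀
  rearrange₃ : ∀ k y c → 71 * k * y * (k * c) ≡ 71 * (k * k) * y * c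
  rearrange₃ = solve-∀

-- Random list assignments, resampling one list, and the expected weight of a trail.

assignments : ∀ n m → ℕ → List (ListAssignment n m)
assignments zero m k = [] ∷ []
assignments (suc n) m k = cartesianProductWith _∷_ (kSubsets m k) (assignments n m k)

assignments-unique : ∀ n m k → Unique (assignments n m k)
assignments-unique zero m k = All.[] AP.∷ AP.[]
assignments-unique (suc n) m k = UP.cartesianProductWith⁺ _∷_ VP.∷-injective (kSubsets-unique m k) (assignments-unique n m k)

∈-assignments : ∀ {k} (L : ListAssignment n m) → IsKLists k L → L LM.∈ assignments n m k
∈-assignments [] _ = hereᴸ refl
∈-assignments (X ∷ L) kL = ∈-cartesianProductWith⁺ _∷_
  (subst (λ k → X LM.∈ kSubsets _ k) (kL zero) (∈-kSubsets X)) (∈-assignments L (kL ∘ suc))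

assignments-kLists : ∀ n {k} {L : ListAssignment n m} → L LM.∈ assignments n m k → IsKLists k L
assignments-kLists {m} (suc n) {k} L∈ v with ∈-cartesianProductWith⁻ _∷_ (kSubsets m k) (assignments n m k) L∈
... | X , L , X∈ , L∈′ , refl with v
... | zero = kSubsets-size m k X∈
... | suc v = assignments-kLists n L∈′ v

length-assignments : ∀ n m k → ∑ (assignments n m k) (λ _ → 1) ≡ (m C k) ^ n
length-assignments zero m k = refl
length-assignments (suc n) m k =
  trans (∑-cartesianProductWith _∷_ (kSubsets m k) (assignments n m k) (λ _ → 1))
  (trans (∑-cong (kSubsets m k) (λ _ → length-assignments n m k))
  (trans (∑-const _ (kSubsets m k)) (cong (_* (m C k) ^ n) (length-kSubsets m k))))

-- Independence of the list at `i` from all others: drawing it afresh preserves the uniform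
-- distribution, with `m C k` outcomes of the new draw.
∑-resample : ∀ n m k (i : Fin n) (f : ListAssignment n m → ℕ) →
  (m C k) * ∑ (assignments n m k) f ≡ ∑ (assignments n m k) (λ L → ∑ (kSubsets m k) (λ X → f (L V.[ i ]≔ X)))
∑-resample (suc n) m k zero f = begin
  (m C k) * ∑ (assignments (suc n) m k) f
    ≡⟨ cong ((m C k) *_) (trans (∑-cartesianProductWith _∷_ Ks As f) (∑-swap Ks As _)) ⟩
  (m C k) * ∑ As (λ L → ∑ Ks (λ X → f (X ∷ L)))
    ≡⟨ cong (_* ∑ As (λ L → ∑ Ks (λ X → f (X ∷ L)))) (length-kSubsets m k) ⟨
  length Ks * ∑ As (λ L → ∑ Ks (λ X → f (X ∷ L)))
    ≡⟨ ∑-const _ Ks ⟨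
  ∑ Ks (λ _ → ∑ As (λ L → ∑ Ks (λ X → f (X ∷ L))))
    ≡⟨ ∑-cartesianProductWith _∷_ Ks As _ ⟨
  ∑ (assignments (suc n) m k) (λ L → ∑ Ks (λ X → f (L V.[ zero ]≔ X))) ∎
  where
  open ≡-Reasoning
  Ks = kSubsets m k
  As = assignments n m k
∑-resample (suc n) m k (suc i) f = begin
  (m C k) * ∑ (assignments (suc n) m k) f
    ≡⟨ cong ((m C k) *_) (∑-cartesianProductWith _∷_ Ks As f) ⟩
  (m C k) * ∑ Ks (λ X → ∑ As (λ L → f (X ∷ L)))
    ≡⟨ ∑-* (m C k) Ks _ ⟨
  ∑ Ks (λ X → (m C k) * ∑ As (λ L → f (X ∷ L)))
    ≡⟨ ∑-cong Ks (λ X → ∑-resample n m k i (λ L → f (X ∷ L))) ⟩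
  ∑ Ks (λ X → ∑ As (λ L → ∑ Ks (λ X′ → f (X ∷ (L V.[ i ]≔ X′)))))
    ≡⟨ ∑-cartesianProductWith _∷_ Ks As _ ⟨
  ∑ (assignments (suc n) m k) (λ L → ∑ Ks (λ X → f (L V.[ suc i ]≔ X))) ∎
  where
  open ≡-Reasoning
  Ks = kSubsets m k
  As = assignments n m k

-- Exponential weight Y ^ repeats of a linked trail, for Markov's inequality.
weight : ℕ → ListAssignment n m → Fin n → Trail n → ℕ
weight Y L v [] = 1
weight Y L v ((u , p) ∷ t) =
  ι (nonempty? (lookup L u ∩ lookup L p)) * Y ^ ∣ lookup L u ∩ seen L v t ∣ * weight Y L v t

weight-linked : ∀ Y (L : ListAssignment n m) v t → Linked L t → weight Y L v t ≡ Y ^ repeats L v t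
weight-linked Y L v [] _ = refl
weight-linked Y L v ((u , p) ∷ t) (ne , lk) = begin
  ι (nonempty? (lookup L u ∩ lookup L p)) * Y ^ a * weight Y L v t
    ≡⟨ cong₂ (λ i w → i * Y ^ a * w) (ι-yes (nonempty? (lookup L u ∩ lookup L p)) ne) (weight-linked Y L v t lk) ⟩
  1 * Y ^ a * Y ^ repeats L v t
    ≡⟨ cong (_* Y ^ repeats L v t) (*-identityˡ (Y ^ a)) ⟩
  Y ^ a * Y ^ repeats L v t
    ≡⟨ ^-distribˡ-+-* Y a _ ⟨
  Y ^ (a + repeats L v t) ∎
  where
  open ≡-Reasoning
  a = ∣ lookup L u ∩ seen L v t ∣

lookup-≔ : (L : ListAssignment n m) (S : Subset n) {u w : Fin n} (X : Subset m) → u ∉ S → w ∈ S →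
           lookup (L V.[ u ]≔ X) w ≡ lookup L w
lookup-≔ L S {u} {w} X u∉ w∈ = VP.lookup∘updateAt′ w u (λ { refl → u∉ w∈ }) L

seen-≔ : ∀ (L : ListAssignment n m) {u} X v t → u ∉ vertices v t → seen (L V.[ u ]≔ X) v t ≡ seen L v t
seen-≔ L X v [] u∉ = lookup-≔ L ⁅ v ⁆ X u∉ (x∈⁅x⁆ v)
seen-≔ L X v ((w , p) ∷ t) u∉ = cong₂ _∪_ (lookup-≔ L _ X u∉ (p⊆p∪q (vertices v t) (x∈⁅x⁆ w))) (seen-≔ L X v t (u∉ ∘ q⊆p∪q ⁅ w ⁆ (vertices v t)))

weight-≔ : ∀ Y (L : ListAssignment n m) {u} X v t → Valid v t → u ∉ vertices v t →
           weight Y (L V.[ u ]≔ X) v t ≡ weight Y L v t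
weight-≔ Y L X v [] ok u∉ = refl
weight-≔ Y L {u} X v ((w , p) ∷ t) (w∉ , p∈ , ok) u∉ =
  cong₂ _*_ (cong₂ _*_ (cong₂ (λ a b → ι (nonempty? (a ∩ b))) ew ep) (cong₂ (λ a b → Y ^ ∣ a ∩ b ∣) ew (seen-≔ L X v t u∉t)))
            (weight-≔ Y L X v t ok u∉t)
  where
  u∉t : u ∉ vertices v t
  u∉t = u∉ ∘ q⊆p∪q ⁅ w ⁆ (vertices v t)
  ew = lookup-≔ L _ X u∉ (p⊆p∪q (vertices v t) (x∈⁅x⁆ w))
  ep = lookup-≔ L _ X u∉t p∈

⊆seen : (L : ListAssignment n m) (v : Fin n) (t : Trail n) {p : Fin n} → p ∈ vertices v t → lookup L p ⊆ seen L v t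
⊆seen L v [] p∈ x∈ with refl ← x∈⁅y⁆⇒x≡y v p∈ = x∈
⊆seen L v ((u , _) ∷ t) p∈ x∈ with x∈p∪q⁻ ⁅ u ⁆ (vertices v t) p∈
... | inj₂ h = q⊆p∪q (lookup L u) _ (⊆seen L v t h x∈)
... | inj₁ h with refl ← x∈⁅y⁆⇒x≡y u h = p⊆p∪q _ x∈

-- The list of the latest vertex `u` is resampled. The weight of the earlier trail does not depend
-- on that list, so on average it is multiplied by `hits`. The bound `s` stays fixed in the
-- induction: one bound `k * s` on the seen colours, hence one `Y`, serves every vertex.
weight-bound : ∀ Z k s (v : Fin n) t → k ≤ m → Valid v t → suc (length t) ≤ s → Z * k * (71 * (k * s)) ≤ m →
  ∑ (assignments n m k) (λ L → weight (suc Z) L v t) * (70 * m) ^ length t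
    ≤ (m C k) ^ n * (71 * (k * k) * suc Z) ^ length t
weight-bound {n} {m} Z k s v [] k≤m ok len small = ≤-reflexive (cong (_* 1) (length-assignments n m k))
weight-bound {n} {m} Z k s v ((u , p) ∷ t) k≤m (u∉ , p∈ , ok) len small =
  *-cancelˡ-≤ N {{>-nonZero (nCk>0 m k k≤m)}} (begin
    N * (∑ As (λ L → weight Y L v t⁺) * (70 * m * q))
      ≡⟨ rearrange₁ N (∑ As (λ L → weight Y L v t⁺)) (70 * m) q ⟩
    70 * m * (N * ∑ As (λ L → weight Y L v t⁺)) * q
      ≤⟨ *-monoˡ-≤ q step ⟩
    b * N * ∑ As (λ L → weight Y L v t) * q
      ≡⟨ rearrange₂ b N (∑ As (λ L → weight Y L v t)) q ⟩
    b * N * (∑ As (λ L → weight Y L v t) * q)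
      ≤⟨ *-monoʳ-≤ (b * N) (weight-bound Z k s v t k≤m ok (≤-trans (n≤1+n _) len) small) ⟩
    b * N * (N ^ n * b ^ length t)
      ≡⟨ rearrange₃ b N (N ^ n) (b ^ length t) ⟩
    N * (N ^ n * (b * b ^ length t)) ∎)
  where
  open ≤-Reasoning
  Y = suc Z
  N = m C k
  As = assignments n m k
  Ks = kSubsets m k
  t⁺ = (u , p) ∷ t
  q = (70 * m) ^ length t
  b = 71 * (k * k) * Y
  factor : ∀ {L} → L LM.∈ As → ∑ Ks (λ X → weight Y (L V.[ u ]≔ X) v t⁺) ≡ weight Y L v t * hits Y k (lookup L p) (seen L v t)
  factor {L} _ = trans (∑-cong Ks λ X → trans
      (cong₂ _*_ (cong₂ _*_
        (cong₂ (λ a b → ι (nonempty? (a ∩ b))) (VP.lookup∘updateAt u L) (lookup-≔ L _ X u∉ p∈))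
        (cong₂ (λ a b → Y ^ ∣ a ∩ b ∣) (VP.lookup∘updateAt u L) (seen-≔ L X v t u∉)))
        (weight-≔ Y L X v t ok u∉))
      (*-comm _ (weight Y L v t)))
    (∑-* (weight Y L v t) Ks _)
  seen-size : ∀ {L} → L LM.∈ As → ∣ seen L v t ∣ ≤ k * s
  seen-size {L} L∈ = ≤-trans (m≤m+n _ (repeats L v t)) (≤-trans (≤-reflexive (seen+repeats L (assignments-kLists n L∈) v t))
    (*-monoʳ-≤ k (≤-trans (n≤1+n _) len)))
  step : 70 * m * (N * ∑ As (λ L → weight Y L v t⁺)) ≤ b * N * ∑ As (λ L → weight Y L v t)
  step = begin
    70 * m * (N * ∑ As (λ L → weight Y L v t⁺))
      ≡⟨ cong (70 * m *_) (∑-resample n m k u (λ L → weight Y L v t⁺)) ⟩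
    70 * m * ∑ As (λ L → ∑ Ks (λ X → weight Y (L V.[ u ]≔ X) v t⁺))
      ≡⟨ ∑-* (70 * m) As _ ⟨
    ∑ As (λ L → 70 * m * ∑ Ks (λ X → weight Y (L V.[ u ]≔ X) v t⁺))
      ≤⟨ ∑-mono As (λ {L} L∈ → begin
        70 * m * ∑ Ks (λ X → weight Y (L V.[ u ]≔ X) v t⁺)             ≡⟨ cong (70 * m *_) (factor L∈) ⟩
        70 * m * (weight Y L v t * hits Y k (lookup L p) (seen L v t))  ≡⟨ swap (70 * m) (weight Y L v t) _ ⟩
        weight Y L v t * (70 * m * hits Y k (lookup L p) (seen L v t))  ≤⟨ *-monoʳ-≤ (weight Y L v t) (hits-bound Z k (k * s) (lookup L p) (seen L v t) (⊆seen L v t p∈) (assignments-kLists n L∈ p) (seen-size L∈) small) ⟩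
        weight Y L v t * (b * N)                                        ≡⟨ *-comm (weight Y L v t) (b * N) ⟩
        b * N * weight Y L v t                                          ∎) ⟩
    ∑ As (λ L → b * N * weight Y L v t)
      ≡⟨ ∑-* (b * N) As _ ⟩
    b * N * ∑ As (λ L → weight Y L v t) ∎
    where
    swap : ∀ a b c → a * (b * c) ≡ b * (a * c)
    swap = solve-∀
  rearrange₁ : ∀ N w a q → N * (w * (a * q)) ≡ a * (N * w) * q
  rearrange₁ = solve-∀
  rearrange₂ : ∀ b N w q → b * N * w * q ≡ b * N * (w * q)
  rearrange₂ = solve-∀
  rearrange₃ : ∀ b N x y → b * N * (x * y) ≡ N * (x * (b * y))
  rearrange₃ = solve-∀

-- Markov's inequality and the bound for a single trail.

bad-count : (n m k : ℕ) → Fin n → Trail n → ℕ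
bad-count n m k v t = ∑ (assignments n m k) (λ L → ι (bad? k L v t))

markov : ∀ Z k n m v (t : Trail n) →
  bad-count n m k v t * suc Z ^ (k * (k ∸ 1) + length t) ≤ ∑ (assignments n m k) (λ L → weight (suc Z) L v t)
markov Z k n m v t = begin
  bad-count n m k v t * y                                    ≡⟨ *-comm (bad-count n m k v t) y ⟩
  y * bad-count n m k v t                                    ≡⟨ ∑-* y (assignments n m k) _ ⟨
  ∑ (assignments n m k) (λ L → y * ι (bad? k L v t))         ≤⟨ ∑-mono (assignments n m k) (λ {L} _ → pointwise L) ⟩
  ∑ (assignments n m k) (λ L → weight (suc Z) L v t)         ∎
  where
  open ≤-Reasoning
  y = suc Z ^ (k * (k ∸ 1) + length t)
  pointwise : ∀ L → y * ι (bad? k L v t) ≤ weight (suc Z) L v t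
  pointwise L with bad? k L v t
  ... | no _ = subst (_≤ weight (suc Z) L v t) (sym (*-zeroʳ y)) z≤n
  ... | yes (_ , lk , many) = begin
    y * 1                      ≡⟨ *-identityʳ y ⟩
    y                          ≤⟨ ^-monoʳ-≤ (suc Z) many ⟩
    suc Z ^ repeats L v t      ≡⟨ weight-linked (suc Z) L v t lk ⟨
    weight (suc Z) L v t       ∎

^-distribʳ-* : ∀ a b j → (a * b) ^ j ≡ a ^ j * b ^ j
^-distribʳ-* a b zero = refl
^-distribʳ-* a b (suc j) = trans (cong (a * b *_) (^-distribʳ-* a b j)) (swap a b (a ^ j) (b ^ j))
  where
  swap : ∀ a b x y → a * b * (x * y) ≡ a * x * (b * y)
  swap = solve-∀

bad-count-invalid : ∀ n m k (v : Fin n) t → ¬ Valid v t → bad-count n m k v t ≡ 0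
bad-count-invalid n m k v t invalid =
  trans (∑-cong (assignments n m k) λ L → ι-no (bad? k L v t) (invalid ∘ proj₁))
        (trans (∑-const 0 (assignments n m k)) (*-zeroʳ (length (assignments n m k))))

-- The expected weight gains one `Y` per edge, and Markov's inequality gives back one for each
-- repetition forced by an edge. These cancel, and the `r` excess repetitions leave `Y` to the power
-- `-r`, at most `(c/m)` to the power `r`.
bad-count-bound : ∀ n m k (v : Fin n) t → 1 ≤ k → k ≤ m →
  bad-count n m k v t * m ^ (k * (k ∸ 1)) * (70 * m) ^ length t
    ≤ (m C k) ^ n * (71 * (k * k)) ^ length t * (k * (71 * (k * suc (length t)))) ^ (k * (k ∸ 1))
bad-count-bound n m k@(suc k′) v t 1≤k k≤m = cases (valid? v t)
  where
  open ≤-Reasoning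
  l = length t
  r = k * (k ∸ 1)
  a = bad-count n m k v t
  c = k * (71 * (k * suc l))
  -- The largest value with `Z * c ≤ m`, as `small` demands; passing to `Y = suc Z` makes up for the
  -- rounding in `m≤Yc`.
  Z = m / c
  Y = suc Z
  m≤Yc : m ≤ Y * c
  m≤Yc = begin
    m                     ≡⟨ m≡m%n+[m/n]*n m c ⟩
    m % c + Z * c         ≤⟨ +-monoˡ-≤ (Z * c) (<⇒≤ (m%n<n m c)) ⟩
    Y * c                 ∎
  small : Z * k * (71 * (k * suc l)) ≤ m
  small = ≤-trans (≤-reflexive (*-assoc Z k _)) (m/n*n≤m m c)
  rearrange₁ : ∀ a x c q y → a * (x * c) * q * y ≡ a * (x * y) * q * c
  rearrange₁ = solve-∀
  rearrange₂ : ∀ a b y c → a * (b * y) * c ≡ a * b * c * y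
  rearrange₂ = solve-∀
  cases : Dec (Valid v t) → a * m ^ r * (70 * m) ^ l ≤ (m C k) ^ n * (71 * (k * k)) ^ l * c ^ r
  cases (no invalid) = subst (λ z → z * m ^ r * (70 * m) ^ l ≤ (m C k) ^ n * (71 * (k * k)) ^ l * c ^ r)
                             (sym (bad-count-invalid n m k v t invalid)) z≤n
  cases (yes ok) = *-cancelʳ-≤ _ _ (Y ^ l) {{m^n≢0 Y l}} (begin
    a * m ^ r * (70 * m) ^ l * Y ^ l
      ≤⟨ *-monoˡ-≤ (Y ^ l) (*-monoˡ-≤ ((70 * m) ^ l) (*-monoʳ-≤ a (^-monoˡ-≤ r m≤Yc))) ⟩
    a * (Y * c) ^ r * (70 * m) ^ l * Y ^ l
      ≡⟨ cong (λ z → a * z * (70 * m) ^ l * Y ^ l) (^-distribʳ-* Y c r) ⟩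
    a * (Y ^ r * c ^ r) * (70 * m) ^ l * Y ^ l
      ≡⟨ rearrange₁ a (Y ^ r) (c ^ r) ((70 * m) ^ l) (Y ^ l) ⟩
    a * (Y ^ r * Y ^ l) * (70 * m) ^ l * c ^ r
      ≡⟨ cong (λ z → a * z * (70 * m) ^ l * c ^ r) (^-distribˡ-+-* Y r l) ⟨
    a * Y ^ (r + l) * (70 * m) ^ l * c ^ r
      ≤⟨ *-monoˡ-≤ (c ^ r) (*-monoˡ-≤ ((70 * m) ^ l) (markov Z k n m v t)) ⟩
    ∑ (assignments n m k) (λ L → weight Y L v t) * (70 * m) ^ l * c ^ r
      ≤⟨ *-monoˡ-≤ (c ^ r) (weight-bound Z k (suc l) v t k≤m ok ≤-refl small) ⟩
    (m C k) ^ n * (71 * (k * k) * Y) ^ l * c ^ r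
      ≡⟨ cong (λ z → (m C k) ^ n * z * c ^ r) (^-distribʳ-* (71 * (k * k)) Y l) ⟩
    (m C k) ^ n * ((71 * (k * k)) ^ l * Y ^ l) * c ^ r
      ≡⟨ rearrange₂ ((m C k) ^ n) ((71 * (k * k)) ^ l) (Y ^ l) (c ^ r) ⟩
    (m C k) ^ n * (71 * (k * k)) ^ l * c ^ r * Y ^ l ∎)

-- Numerical estimates: the number of trees, exponential decay, and a telescoping sum.

-- (1 + x)ⁱ ≤ (2 + y)/(2 - y) for x = 4/E and y = ix = 2(E - d)/E.
padé : ∀ i d → (d + 2 * i + 4) ^ i * d ≤ (d + 2 * i) ^ i * (d + 2 * i + 2 * i)
padé zero d = *-monoʳ-≤ 1 (≤-trans (m≤m+n d 0) (m≤m+n (d + 0) 0))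
padé (suc i) d = *-cancelʳ-≤ _ _ (2 + d) (begin
  (E + 4) * (E + 4) ^ i * d * (2 + d)                 ≡⟨ rearrange₁ (E + 4) ((E + 4) ^ i) d ⟩
  (E + 4) * d * ((E + 4) ^ i * (2 + d))               ≤⟨ *-monoʳ-≤ ((E + 4) * d) ih ⟩
  (E + 4) * d * (E ^ i * (E + 2 * i))                 ≡⟨ rearrange₂ (E + 4) d (E ^ i) (E + 2 * i) ⟩
  E ^ i * ((E + 4) * d * (E + 2 * i))                 ≤⟨ *-monoʳ-≤ (E ^ i) (≤-trans (m≤m+n _ (8 * E + 16 * i * (1 + i))) (≤-reflexive (cubic i d))) ⟩
  E ^ i * (E * (E + 2 * suc i) * (2 + d))             ≡⟨ rearrange₃ (E ^ i) E (E + 2 * suc i) (2 + d) ⟩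
  E * E ^ i * (E + 2 * suc i) * (2 + d)               ∎)
  where
  open ≤-Reasoning
  E = d + 2 * suc i
  ih : (E + 4) ^ i * (2 + d) ≤ E ^ i * (E + 2 * i)
  ih = subst (λ E → (E + 4) ^ i * (2 + d) ≤ E ^ i * (E + 2 * i)) (shift i d) (padé i (2 + d))
    where
    shift : ∀ i d → 2 + d + 2 * i ≡ d + 2 * suc i
    shift = solve-∀
  rearrange₁ : ∀ a b d → a * b * d * (2 + d) ≡ a * d * (b * (2 + d))
  rearrange₁ = solve-∀
  rearrange₂ : ∀ a d b c → a * d * (b * c) ≡ b * (a * d * c)
  rearrange₂ = solve-∀
  rearrange₃ : ∀ b e c d → b * (e * c * d) ≡ e * b * c * d
  rearrange₃ = solve-∀
  cubic : ∀ i d → (d + 2 * suc i + 4) * d * (d + 2 * suc i + 2 * i) + (8 * (d + 2 * suc i) + 16 * i * (1 + i))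
                  ≡ (d + 2 * suc i) * (d + 2 * suc i + 2 * suc i) * (2 + d)
  cubic = solve-∀

-- `padé` with `i = Δ` and `d = 3Δ`, so that `E = 5Δ`, `y = 4/5` and `(2 + y)/(2 - y) = 7/3`.
[5Δ+4]^Δ : ∀ Δ → 1 ≤ Δ → (4 + 5 * Δ) ^ Δ * 3 ≤ (5 * Δ) ^ Δ * 7
[5Δ+4]^Δ Δ@(suc _) _ = *-cancelʳ-≤ _ _ Δ (begin
  (4 + 5 * Δ) ^ Δ * 3 * Δ                            ≡⟨ trans (*-assoc ((4 + 5 * Δ) ^ Δ) 3 Δ) (cong (λ b → b ^ Δ * (3 * Δ)) (e₁ Δ)) ⟩
  (3 * Δ + 2 * Δ + 4) ^ Δ * (3 * Δ)                  ≤⟨ padé Δ (3 * Δ) ⟩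
  (3 * Δ + 2 * Δ) ^ Δ * (3 * Δ + 2 * Δ + 2 * Δ)      ≡⟨ cong₂ (λ b c → b ^ Δ * c) (e₂ Δ) (e₃ Δ) ⟩
  (5 * Δ) ^ Δ * (7 * Δ)                              ≡⟨ *-assoc ((5 * Δ) ^ Δ) 7 Δ ⟨
  (5 * Δ) ^ Δ * 7 * Δ                                ∎)
  where
  open ≤-Reasoning
  e₁ : ∀ x → 4 + 5 * x ≡ 3 * x + 2 * x + 4
  e₁ = solve-∀
  e₂ : ∀ x → 3 * x + 2 * x ≡ 5 * x
  e₂ = solve-∀
  e₃ : ∀ x → 3 * x + 2 * x + 2 * x ≡ 7 * x
  e₃ = solve-∀

-- A single term of the binomial expansion. The factor `y ^ j` on the right replaces the exponent
-- `N - j`, so `j > N` needs no exception.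
binomial-term : ∀ x y N j → (N C j) * x ^ j * y ^ N ≤ (x + y) ^ N * y ^ j
binomial-term x y N zero = begin
  1 * 1 * y ^ N       ≡⟨ *-identityˡ (y ^ N) ⟩
  y ^ N               ≤⟨ ^-monoˡ-≤ N (m≤n+m y x) ⟩
  (x + y) ^ N         ≡⟨ *-identityʳ _ ⟨
  (x + y) ^ N * 1     ∎
  where open ≤-Reasoning
binomial-term x y zero (suc j) = z≤n
binomial-term x y (suc N) (suc j) = begin
  (suc N C suc j) * (x * x ^ j) * (y * y ^ N)
    ≡⟨ cong (λ c → c * (x * x ^ j) * (y * y ^ N)) (nCk+nC[k+1]≡[n+1]C[k+1] N j) ⟨
  (N C j + N C suc j) * (x * x ^ j) * (y * y ^ N)
    ≡⟨ rearrange₁ (N C j) (N C suc j) x y (x ^ j) (y ^ N) ⟩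
  x * y * ((N C j) * x ^ j * y ^ N) + y * ((N C suc j) * (x * x ^ j) * y ^ N)
    ≤⟨ +-mono-≤ (*-monoʳ-≤ (x * y) (binomial-term x y N j)) (*-monoʳ-≤ y (binomial-term x y N (suc j))) ⟩
  x * y * ((x + y) ^ N * y ^ j) + y * ((x + y) ^ N * (y * y ^ j))
    ≡⟨ rearrange₂ x y ((x + y) ^ N) (y ^ j) ⟩
  (x + y) * (x + y) ^ N * (y * y ^ j) ∎
  where
  open ≤-Reasoning
  rearrange₁ : ∀ a b x y p q → (a + b) * (x * p) * (y * q) ≡ x * y * (a * p * q) + y * (b * (x * p) * q)
  rearrange₁ = solve-∀
  rearrange₂ : ∀ x y p q → x * y * (p * q) + y * (p * (y * q)) ≡ (x + y) * p * (y * q)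
  rearrange₂ = solve-∀

-- `binomial-term` at the ratio `x = 4/(5Δ)` gives at most `(7/3)ˢ (5Δ/4)ˡ = (7/3)(35Δ/12)ˡ`. With
-- `x = 1/Δ` the same estimate would yield `3Δ` per edge, leaving no room below the 3 in `3k²Δ ≤ m`.
tree-count : ∀ Δ l → 1 ≤ Δ → ((Δ * suc l) C l) * 12 ^ l ≤ 3 * (35 * Δ) ^ l
tree-count Δ@(suc _) l 1≤Δ = *-cancelʳ-≤ _ _ 3 (≤-trans 3T≤7 (≤-trans (*-monoˡ-≤ ((35 * Δ) ^ l) {7} {9} (m≤m+n 7 2)) (≤-reflexive (nine ((35 * Δ) ^ l)))))
  where
  open ≤-Reasoning
  nine : ∀ x → 9 * x ≡ 3 * x * 3
  nine = solve-∀
  s = suc l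
  T = (Δ * s) C l
  p = (5 * Δ) ^ (Δ * s)
  power : (4 + 5 * Δ) ^ (Δ * s) * 3 ^ s ≤ p * 7 ^ s
  power = begin
    (4 + 5 * Δ) ^ (Δ * s) * 3 ^ s          ≡⟨ cong (_* 3 ^ s) (^-*-assoc (4 + 5 * Δ) Δ s) ⟨
    ((4 + 5 * Δ) ^ Δ) ^ s * 3 ^ s          ≡⟨ ^-distribʳ-* ((4 + 5 * Δ) ^ Δ) 3 s ⟨
    ((4 + 5 * Δ) ^ Δ * 3) ^ s              ≤⟨ ^-monoˡ-≤ s ([5Δ+4]^Δ Δ 1≤Δ) ⟩
    ((5 * Δ) ^ Δ * 7) ^ s                  ≡⟨ ^-distribʳ-* ((5 * Δ) ^ Δ) 7 s ⟩
    ((5 * Δ) ^ Δ) ^ s * 7 ^ s              ≡⟨ cong (_* 7 ^ s) (^-*-assoc (5 * Δ) Δ s) ⟩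
    p * 7 ^ s                              ∎
  3T≤7 : T * 12 ^ l * 3 ≤ 7 * (35 * Δ) ^ l
  3T≤7 = *-cancelʳ-≤ _ _ p {{m^n≢0 (5 * Δ) (Δ * s)}} (begin
    T * 12 ^ l * 3 * p                                  ≡⟨ cong (λ z → T * z * 3 * p) (^-distribʳ-* 4 3 l) ⟩
    T * (4 ^ l * 3 ^ l) * 3 * p                         ≡⟨ rearrange₁ T (4 ^ l) (3 ^ l) p ⟩
    T * 4 ^ l * p * 3 ^ s                               ≤⟨ *-monoˡ-≤ (3 ^ s) (binomial-term 4 (5 * Δ) (Δ * s) l) ⟩
    (4 + 5 * Δ) ^ (Δ * s) * (5 * Δ) ^ l * 3 ^ s         ≡⟨ rearrange₂ ((4 + 5 * Δ) ^ (Δ * s)) ((5 * Δ) ^ l) (3 ^ s) ⟩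
    (4 + 5 * Δ) ^ (Δ * s) * 3 ^ s * (5 * Δ) ^ l         ≤⟨ *-monoˡ-≤ ((5 * Δ) ^ l) power ⟩
    p * 7 ^ s * (5 * Δ) ^ l                             ≡⟨ rearrange₃ p (7 ^ l) ((5 * Δ) ^ l) ⟩
    7 * (7 ^ l * (5 * Δ) ^ l) * p                       ≡⟨ cong (λ z → 7 * z * p) (^-distribʳ-* 7 (5 * Δ) l) ⟨
    7 * (7 * (5 * Δ)) ^ l * p                           ≡⟨ cong (λ z → 7 * z ^ l * p) (*-assoc 7 5 Δ) ⟨
    7 * (35 * Δ) ^ l * p                                ∎)
    where
    rearrange₁ : ∀ t a b p → t * (a * b) * 3 * p ≡ t * a * p * (3 * b)
    rearrange₁ = solve-∀
    rearrange₂ : ∀ a b c → a * b * c ≡ a * c * b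
    rearrange₂ = solve-∀
    rearrange₃ : ∀ p a b → p * (7 * a) * b ≡ 7 * (a * b) * p
    rearrange₃ = solve-∀

-- Up to `s = 72r` both factors are compared separately. Beyond, a step from `s` to `s + 1`
-- multiplies `sʳ` by at most 72/71, by Bernoulli's inequality, so `sʳ (71/72)ˢ` no longer
-- increases.
polynomial-decay : ∀ r s → s ^ r * 71 ^ s ≤ (72 * r) ^ r * 72 ^ s
polynomial-decay r s = by-cases s (≤-total s (72 * r))
  where
  open ≤-Reasoning
  small : ∀ s → s ≤ 72 * r → s ^ r * 71 ^ s ≤ (72 * r) ^ r * 72 ^ s
  small s s≤ = *-mono-≤ (^-monoˡ-≤ r s≤) (^-monoˡ-≤ s (n≤1+n 71))
  decreasing : ∀ s → 72 * r ≤ s → 71 * suc s ^ r ≤ 72 * s ^ r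
  decreasing s big = *-cancelʳ-≤ _ _ (suc s) (begin
    71 * suc s ^ r * suc s              ≡⟨ rearrange 71 (suc s ^ r) (suc s) ⟩
    suc s ^ r * (71 * suc s)            ≤⟨ *-monoʳ-≤ (suc s ^ r) d-bound ⟩
    suc s ^ r * (72 * d)                ≡⟨ rearrange′ 72 (suc s ^ r) d ⟩
    72 * (suc s ^ r * d)                ≤⟨ *-monoʳ-≤ 72 (bernoulli s r d (m+[n∸m]≡n r≤)) ⟩
    72 * (s ^ r * suc s)                ≡⟨ *-assoc 72 (s ^ r) (suc s) ⟨
    72 * s ^ r * suc s                  ∎)
    where
    d = suc s ∸ r
    r≤ : r ≤ suc s
    r≤ = ≤-trans (m≤m+n r (71 * r)) (≤-trans big (n≤1+n s))
    d-bound : 71 * suc s ≤ 72 * d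
    d-bound = +-cancelʳ-≤ (72 * r) _ _ (begin
      71 * suc s + 72 * r     ≤⟨ +-monoʳ-≤ (71 * suc s) (≤-trans big (n≤1+n s)) ⟩
      71 * suc s + suc s      ≡⟨ +-comm (71 * suc s) (suc s) ⟩
      72 * suc s              ≡⟨ cong (72 *_) (m∸n+n≡m r≤) ⟨
      72 * (d + r)            ≡⟨ *-distribˡ-+ 72 d r ⟩
      72 * d + 72 * r         ∎)
    rearrange : ∀ a b c → a * b * c ≡ b * (a * c)
    rearrange = solve-∀
    rearrange′ : ∀ a b c → b * (a * c) ≡ a * (b * c)
    rearrange′ = solve-∀
  by-cases : ∀ s → s ≤ 72 * r ⊎ 72 * r ≤ s → s ^ r * 71 ^ s ≤ (72 * r) ^ r * 72 ^ s
  by-cases s (inj₁ s≤) = small s s≤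
  by-cases zero (inj₂ _) = small 0 z≤n
  by-cases (suc s) (inj₂ big) with m≤n⇒m<n∨m≡n big
  ... | inj₂ eq = small (suc s) (≤-reflexive (sym eq))
  ... | inj₁ lt = begin
    suc s ^ r * (71 * 71 ^ s)          ≡⟨ rearrange (suc s ^ r) 71 (71 ^ s) ⟩
    71 * suc s ^ r * 71 ^ s            ≤⟨ *-monoˡ-≤ (71 ^ s) (decreasing s (≤-pred lt)) ⟩
    72 * s ^ r * 71 ^ s                ≡⟨ *-assoc 72 (s ^ r) _ ⟩
    72 * (s ^ r * 71 ^ s)              ≤⟨ *-monoʳ-≤ 72 (by-cases s (inj₂ (≤-pred lt))) ⟩
    72 * ((72 * r) ^ r * 72 ^ s)       ≡⟨ rearrange′ 72 ((72 * r) ^ r) (72 ^ s) ⟩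
    (72 * r) ^ r * (72 * 72 ^ s)       ∎
    where
    rearrange : ∀ a b c → a * (b * c) ≡ b * a * c
    rearrange = solve-∀
    rearrange′ : ∀ a b c → a * (b * c) ≡ b * (a * c)
    rearrange′ = solve-∀

-- The numbers `1/((i+1)(i+2))` for `i < K` sum to `K/(K+1)`. This sums the bounds for all tree
-- sizes without an infinite series.
telescope : ∀ (f : ℕ → ℕ) B → (∀ i → f i * (suc i * suc (suc i)) ≤ B) → ∀ K → suc K * ∑ (downFrom K) f ≤ K * B
telescope f B h zero = z≤n
telescope f B h (suc K) = *-cancelʳ-≤ _ _ (suc K) (begin
  suc (suc K) * (f K + S) * suc K                              ≡⟨ rearrange₁ K (f K) S ⟩
  f K * (suc K * suc (suc K)) + suc (suc K) * (suc K * S)      ≤⟨ +-mono-≤ (h K) (*-monoʳ-≤ (suc (suc K)) (telescope f B h K)) ⟩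
  B + suc (suc K) * (K * B)                                    ≡⟨ rearrange₂ K B ⟩
  suc K * B * suc K                                            ∎)
  where
  open ≤-Reasoning
  S = ∑ (downFrom K) f
  rearrange₁ : ∀ k f s → suc (suc k) * (f + s) * suc k ≡ f * (suc k * suc (suc k)) + suc (suc k) * (suc k * s)
  rearrange₁ = solve-∀
  rearrange₂ : ∀ k b → b + suc (suc k) * (k * b) ≡ suc k * b * suc k
  rearrange₂ = solve-∀

-- The union bound over all trails of a given size.

∑-bound : (xs : List A) {f : A → ℕ} {X B : ℕ} → (∀ {x} → x LM.∈ xs → f x * X ≤ B) → ∑ xs f * X ≤ length xs * B
∑-bound xs {f} {X} {B} h = begin
  ∑ xs f * X               ≡⟨ *-comm (∑ xs f) X ⟩
  X * ∑ xs f               ≡⟨ ∑-* X xs f ⟨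
  ∑ xs (λ x → X * f x)     ≤⟨ ∑-mono xs (λ {x} x∈ → ≤-trans (≤-reflexive (*-comm X (f x))) (h x∈)) ⟩
  ∑ xs (λ _ → B)           ≡⟨ ∑-const B xs ⟩
  length xs * B            ∎
  where open ≤-Reasoning

bad-total : Graph n → (m k l : ℕ) → ℕ
bad-total {n} G m k l = ∑ (allFin n) (λ v → ∑ (trails G l v) (bad-count n m k v))

bad-total-bound : (G : Graph n) → ∀ m k l → 1 ≤ k → k ≤ m →
  bad-total G m k l * (m ^ (k * (k ∸ 1)) * (70 * m) ^ l)
    ≤ n * (((maxDegree G * suc l) C l) * ((m C k) ^ n * (71 * (k * k)) ^ l * (k * (71 * (k * suc l))) ^ (k * (k ∸ 1))))
bad-total-bound {n} G m k l 1≤k k≤m = ≤-trans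
  (∑-bound (allFin n) {X = X} {B = c * b} λ {v} _ →
    ≤-trans (∑-bound (trails G l v) (per-trail v)) (*-monoˡ-≤ b (length-trails G l v)))
  (≤-reflexive (cong (_* (c * b)) (length-tabulate {n = n} (λ i → i))))
  where
  X = m ^ (k * (k ∸ 1)) * (70 * m) ^ l
  c = (maxDegree G * suc l) C l
  b = (m C k) ^ n * (71 * (k * k)) ^ l * (k * (71 * (k * suc l))) ^ (k * (k ∸ 1))
  per-trail : ∀ v {t} → t LM.∈ trails G l v → bad-count n m k v t * X ≤ b
  per-trail v {t} t∈ with refl ← trans (sym (+-identityʳ l)) (sym (grow-length G _ l _ [] t∈)) =
    ≤-trans (≤-reflexive (sym (*-assoc (bad-count n m k v t) _ _))) (bad-count-bound n m k v t 1≤k k≤m)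

-- The inequality for the number of trails, the bound for each of them and the two
-- hypotheses on m combine to P(bad) ≤ K sʳ (71/72)ˡ / Cᵏᵏ.
cancel-sizes : ∀ a n T N C Δ m k i → let l = k + i ; s = suc l ; r = k * (k ∸ 1) in
  1 ≤ n → 1 ≤ Δ → 1 ≤ k →
  a * (m ^ r * (70 * m) ^ l) ≤ n * (T * (N * (71 * (k * k)) ^ l * (k * (71 * (k * s))) ^ r)) →
  T * 12 ^ l ≤ 3 * (35 * Δ) ^ l →
  3 * (k * k) * Δ ≤ m →
  C ^ (k * k) * n * Δ ^ k ≤ m ^ (k * k) →
  a * C ^ (k * k) * 72 ^ l ≤ 3 * (3 * (k * k)) ^ k * (71 * (k * k)) ^ r * N * (71 ^ l * s ^ r)
cancel-sizes a n T N C Δ@(suc _) m k@(suc _) i 1≤n _ _ count trees mΔ mC =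
  *-cancelʳ-≤ _ _ (n * Δ ^ k) {{>-nonZero (*-mono-≤ 1≤n (m^n>0 Δ k))}} (begin
    a * C ^ (k * k) * 72 ^ l * (n * Δ ^ k)        ≡⟨ rearrange₁ a (C ^ (k * k)) (72 ^ l) n (Δ ^ k) ⟩
    a * (C ^ (k * k) * n * Δ ^ k) * 72 ^ l        ≤⟨ *-monoˡ-≤ (72 ^ l) (*-monoʳ-≤ a mC) ⟩
    a * m ^ (k * k) * 72 ^ l                      ≤⟨ cancelled ⟩
    D ^ k * 3 * n * N * 71 ^ l * c ^ r            ≡⟨ cong₂ (λ x y → x * 3 * n * N * 71 ^ l * y) (^-distribʳ-* (3 * (k * k)) Δ k) c^r ⟩
    (3 * (k * k)) ^ k * Δ ^ k * 3 * n * N * 71 ^ l * ((71 * (k * k)) ^ r * s ^ r)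
      ≡⟨ rearrange₂ ((3 * (k * k)) ^ k) (Δ ^ k) n N (71 ^ l) ((71 * (k * k)) ^ r) (s ^ r) ⟩
    3 * (3 * (k * k)) ^ k * (71 * (k * k)) ^ r * N * (71 ^ l * s ^ r) * (n * Δ ^ k) ∎)
  where
  open ≤-Reasoning
  l = k + i
  s = suc l
  r = k * (k ∸ 1)
  c = k * (71 * (k * s))
  D = 3 * (k * k) * Δ
  E = 35 * (k * k) * Δ
  c^r : c ^ r ≡ (71 * (k * k)) ^ r * s ^ r
  c^r = trans (cong (_^ r) (e k s)) (^-distribʳ-* (71 * (k * k)) s r)
    where
    e : ∀ k s → k * (71 * (k * s)) ≡ 71 * (k * k) * s
    e = solve-∀
  m^kk : m ^ r * m ^ k ≡ m ^ (k * k)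
  m^kk = trans (sym (^-distribˡ-+-* m r k)) (cong (m ^_) (trans (+-comm r k) (sym (*-suc k (k ∸ 1)))))
  -- The identities `3 * 840 = 72 * 35` and `840 = 70 * 12` are the equation
  -- `(35/12)(71/70)/3 = 71/72` cleared of fractions.
  D·840 : D ^ l * 840 ^ l ≡ 72 ^ l * E ^ l
  D·840 = trans (sym (^-distribʳ-* D 840 l)) (trans (cong (_^ l) (e (k * k) Δ)) (^-distribʳ-* 72 E l))
    where
    e : ∀ k d → 3 * k * d * 840 ≡ 72 * (35 * k * d)
    e = solve-∀
  [840m]^l : (70 * m) ^ l * 12 ^ l ≡ m ^ k * m ^ i * 840 ^ l
  [840m]^l = trans (sym (^-distribʳ-* (70 * m) 12 l)) (trans (cong (_^ l) (e m)) (trans (^-distribʳ-* m 840 l) (cong (_* 840 ^ l) (^-distribˡ-+-* m k i))))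
    where
    e : ∀ m → 70 * m * 12 ≡ m * 840
    e = solve-∀
  [71E]^l : (35 * Δ) ^ l * (71 * (k * k)) ^ l ≡ 71 ^ l * E ^ l
  [71E]^l = trans (sym (^-distribʳ-* (35 * Δ) (71 * (k * k)) l)) (trans (cong (_^ l) (e (k * k) Δ)) (^-distribʳ-* 71 E l))
    where
    e : ∀ k d → 35 * d * (71 * k) ≡ 71 * (35 * k * d)
    e = solve-∀
  cancelled : a * m ^ (k * k) * 72 ^ l ≤ D ^ k * 3 * n * N * 71 ^ l * c ^ r
  cancelled = *-cancelʳ-≤ _ _ (E ^ l) {{m^n≢0 E l}} (begin
    a * m ^ (k * k) * 72 ^ l * E ^ l
      ≡⟨ *-assoc (a * m ^ (k * k)) (72 ^ l) (E ^ l) ⟩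
    a * m ^ (k * k) * (72 ^ l * E ^ l)
      ≡⟨ cong₂ (λ x y → a * x * y) m^kk D·840 ⟨
    a * (m ^ r * m ^ k) * (D ^ l * 840 ^ l)
      ≡⟨ cong (λ x → a * (m ^ r * m ^ k) * (x * 840 ^ l)) (^-distribˡ-+-* D k i) ⟩
    a * (m ^ r * m ^ k) * (D ^ k * D ^ i * 840 ^ l)
      -- Only `i` of the `l = k + i` factors `D` are raised to `m`. The remaining `D ^ k` carries
      -- the `Δ ^ k` for which the growth hypothesis pays, and its place in `m ^ l` is taken by the
      -- `m ^ k` split off from `m ^ (k * k)`.
      ≤⟨ *-monoʳ-≤ (a * (m ^ r * m ^ k)) (*-monoˡ-≤ (840 ^ l) (*-monoʳ-≤ (D ^ k) (^-monoˡ-≤ i mΔ))) ⟩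
    a * (m ^ r * m ^ k) * (D ^ k * m ^ i * 840 ^ l)
      ≡⟨ rearrange₃ a (m ^ r) (m ^ k) (D ^ k) (m ^ i) (840 ^ l) ⟩
    D ^ k * (a * (m ^ r * (m ^ k * m ^ i * 840 ^ l)))
      ≡⟨ cong (λ x → D ^ k * (a * (m ^ r * x))) [840m]^l ⟨
    D ^ k * (a * (m ^ r * ((70 * m) ^ l * 12 ^ l)))
      ≡⟨ rearrange₄ (D ^ k) a (m ^ r) ((70 * m) ^ l) (12 ^ l) ⟩
    D ^ k * (a * (m ^ r * (70 * m) ^ l)) * 12 ^ l
      ≤⟨ *-monoˡ-≤ (12 ^ l) (*-monoʳ-≤ (D ^ k) count) ⟩
    D ^ k * (n * (T * (N * (71 * (k * k)) ^ l * c ^ r))) * 12 ^ l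
      ≡⟨ rearrange₅ (D ^ k) n T N ((71 * (k * k)) ^ l) (c ^ r) (12 ^ l) ⟩
    D ^ k * n * N * c ^ r * (71 * (k * k)) ^ l * (T * 12 ^ l)
      ≤⟨ *-monoʳ-≤ (D ^ k * n * N * c ^ r * (71 * (k * k)) ^ l) trees ⟩
    D ^ k * n * N * c ^ r * (71 * (k * k)) ^ l * (3 * (35 * Δ) ^ l)
      ≡⟨ rearrange₆ (D ^ k) n N (c ^ r) ((71 * (k * k)) ^ l) ((35 * Δ) ^ l) ⟩
    D ^ k * 3 * n * N * c ^ r * ((35 * Δ) ^ l * (71 * (k * k)) ^ l)
      ≡⟨ cong (D ^ k * 3 * n * N * c ^ r *_) [71E]^l ⟩
    D ^ k * 3 * n * N * c ^ r * (71 ^ l * E ^ l)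
      ≡⟨ rearrange₇ (D ^ k * 3 * n * N) (c ^ r) (71 ^ l) (E ^ l) ⟩
    D ^ k * 3 * n * N * 71 ^ l * c ^ r * E ^ l ∎)
    where
    rearrange₃ : ∀ a x y d z e → a * (x * y) * (d * z * e) ≡ d * (a * (x * (y * z * e)))
    rearrange₃ = solve-∀
    rearrange₄ : ∀ d a x y z → d * (a * (x * (y * z))) ≡ d * (a * (x * y)) * z
    rearrange₄ = solve-∀
    rearrange₅ : ∀ d n t N x c y → d * (n * (t * (N * x * c))) * y ≡ d * n * N * c * x * (t * y)
    rearrange₅ = solve-∀
    rearrange₆ : ∀ d n N c x y → d * n * N * c * x * (3 * y) ≡ d * 3 * n * N * c * (y * x)
    rearrange₆ = solve-∀
    rearrange₇ : ∀ b c x y → b * c * (x * y) ≡ b * x * c * y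
    rearrange₇ = solve-∀
  rearrange₁ : ∀ a c p n d → a * c * p * (n * d) ≡ a * (c * n * d) * p
  rearrange₁ = solve-∀
  rearrange₂ : ∀ x d n N p y q → x * d * 3 * n * N * p * (y * q) ≡ 3 * x * y * N * (p * q) * (n * d)
  rearrange₂ = solve-∀

-- In `144 = 2 * 72` the 2 comes from `s(s+1) ≤ 2s²` and the 72 from `s = l + 1`. The exponent
-- `r + 2` joins the `sʳ` of the bound to the quadratic factor that `telescope` asks for. The `suc`
-- makes the value positive, so that it can be cancelled.
threshold : ℕ → ℕ
threshold k = suc (144 * (3 * (3 * (k * k)) ^ k * (71 * (k * k)) ^ r) * (72 * (r + 2)) ^ (r + 2))
  where r = k * (k ∸ 1)

size-bound : ∀ a N j k l → 1 ≤ k → let s = suc l ; r = k * (k ∸ 1) in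
  a * (threshold k * suc j) ^ (k * k) * 72 ^ l ≤ 3 * (3 * (k * k)) ^ k * (71 * (k * k)) ^ r * N * (71 ^ l * s ^ r) →
  suc j * a * (s * suc s) ≤ N
size-bound a N j k@(suc _) l _ h = *-cancelˡ-≤ W (begin
  W * (suc j * a * q)              ≡⟨ rearrange₁ W (suc j) a q ⟩
  -- One power of the growth constant is enough: `W` pays for all constants, and `suc j` sharpens
  -- the probability.
  a * (W * suc j) * q              ≤⟨ *-monoˡ-≤ q (*-monoʳ-≤ a (≤-trans (≤-reflexive (sym (^-identityʳ (W * suc j)))) (^-monoʳ-≤ (W * suc j) {1} {k * k} (s≤s z≤n)))) ⟩
  a * (W * suc j) ^ (k * k) * q    ≤⟨ *-cancelʳ-≤ (a * (W * suc j) ^ (k * k) * q) (144 * K * C₀ * N) (72 ^ l) {{m^n≢0 72 l}} main ⟩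
  144 * K * C₀ * N                 ≤⟨ *-monoˡ-≤ N {144 * K * C₀} {W} (n≤1+n _) ⟩
  W * N                            ∎)
  where
  open ≤-Reasoning
  s = suc l
  r = k * (k ∸ 1)
  q = s * suc s
  K = 3 * (3 * (k * k)) ^ k * (71 * (k * k)) ^ r
  C₀ = (72 * (r + 2)) ^ (r + 2)
  W = threshold k
  decay : s ^ (r + 2) * 71 ^ l ≤ 72 * (C₀ * 72 ^ l)
  decay = begin
    s ^ (r + 2) * 71 ^ l        ≤⟨ *-monoʳ-≤ (s ^ (r + 2)) (m≤n*m (71 ^ l) 71) ⟩
    s ^ (r + 2) * 71 ^ s        ≤⟨ polynomial-decay (r + 2) s ⟩
    C₀ * (72 * 72 ^ l)          ≡⟨ swap C₀ 72 (72 ^ l) ⟩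
    72 * (C₀ * 72 ^ l)          ∎
    where
    swap : ∀ a b c → a * (b * c) ≡ b * (a * c)
    swap = solve-∀
  q≤ : q ≤ 2 * s ^ 2
  q≤ = ≤-trans (m≤m+n q (s * l)) (≤-reflexive (e l))
    where
    e : ∀ l → suc l * suc (suc l) + suc l * l ≡ 2 * (suc l * (suc l * 1))
    e = solve-∀
  main : a * (W * suc j) ^ (k * k) * q * 72 ^ l ≤ 144 * K * C₀ * N * 72 ^ l
  main = begin
    a * (W * suc j) ^ (k * k) * q * 72 ^ l      ≡⟨ rearrange₂ (a * (W * suc j) ^ (k * k)) q (72 ^ l) ⟩
    a * (W * suc j) ^ (k * k) * 72 ^ l * q      ≤⟨ *-mono-≤ h q≤ ⟩
    K * N * (71 ^ l * s ^ r) * (2 * s ^ 2)      ≡⟨ rearrange₃ (K * N) (71 ^ l) (s ^ r) (s ^ 2) ⟩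
    K * N * 2 * (s ^ r * s ^ 2 * 71 ^ l)        ≡⟨ cong (λ x → K * N * 2 * (x * 71 ^ l)) (^-distribˡ-+-* s r 2) ⟨
    K * N * 2 * (s ^ (r + 2) * 71 ^ l)          ≤⟨ *-monoʳ-≤ (K * N * 2) decay ⟩
    K * N * 2 * (72 * (C₀ * 72 ^ l))            ≡⟨ rearrange₄ K N C₀ (72 ^ l) ⟩
    144 * K * C₀ * N * 72 ^ l                   ∎
    where
    rearrange₂ : ∀ a b c → a * b * c ≡ a * c * b
    rearrange₂ = solve-∀
    rearrange₃ : ∀ k x y z → k * (x * y) * (2 * z) ≡ k * 2 * (y * z * x)
    rearrange₃ = solve-∀
    rearrange₄ : ∀ k n c x → k * n * 2 * (72 * (c * x)) ≡ 144 * k * c * n * x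
    rearrange₄ = solve-∀
  rearrange₁ : ∀ w j a q → w * (j * a * q) ≡ a * (w * j) * q
  rearrange₁ = solve-∀

bad-total-small : (G : Graph n) → ∀ m k j i → 1 ≤ n → 1 ≤ k → k ≤ m →
  3 * (k * k) * maxDegree G ≤ m →
  (threshold k * suc j) ^ (k * k) * n * maxDegree G ^ k ≤ m ^ (k * k) →
  suc j * bad-total G m k (k + i) * (suc (k + i) * suc (suc (k + i))) ≤ (m C k) ^ n
bad-total-small {n} G m@(suc _) k@(suc _) j i 1≤n 1≤k k≤m mΔ mC =
  by-degree (maxDegree G) mΔ mC (bad-total-bound G m k l 1≤k k≤m)
  where
  l = k + i
  r = k * (k ∸ 1)
  a = bad-total G m k l
  N = (m C k) ^ n
  X = m ^ r * (70 * m) ^ l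
  by-degree : ∀ Δ → 3 * (k * k) * Δ ≤ m → (threshold k * suc j) ^ (k * k) * n * Δ ^ k ≤ m ^ (k * k) →
    a * X ≤ n * (((Δ * suc l) C l) * (N * (71 * (k * k)) ^ l * (k * (71 * (k * suc l))) ^ r)) →
    suc j * a * (suc l * suc (suc l)) ≤ N
  -- Without edges there are no candidates, and `0 C l` vanishes as `l ≥ k ≥ 1`. For larger degrees
  -- the ratio `4/(5Δ)` of `tree-count` makes sense.
  by-degree zero _ _ count = subst (λ a → suc j * a * (suc l * suc (suc l)) ≤ N) (sym a≡0)
    (subst (λ z → z * (suc l * suc (suc l)) ≤ N) (sym (*-zeroʳ j)) z≤n)
    where
    a≡0 : a ≡ 0
    a≡0 = n≤0⇒n≡0 (≤-trans (m≤m*n a X {{m*n≢0 (m ^ r) ((70 * m) ^ l) {{m^n≢0 m r}} {{m^n≢0 (70 * m) l}}}})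
            (≤-trans count (≤-reflexive (*-zeroʳ n))))
  by-degree Δ@(suc _) mΔ mC count = size-bound a N j k l 1≤k
    (cancel-sizes a n ((Δ * suc l) C l) N (threshold k * suc j) Δ m k i 1≤n (s≤s z≤n) 1≤k count
      (tree-count Δ l (s≤s z≤n)) mΔ mC)

-- From the expected number of bad trails to the failure probability.

badness : Graph n → ∀ k → ListAssignment n m → ℕ
badness {n} G k L = ∑ (downFrom n) λ i → ∑ (allFin n) λ v → ∑ (trails G (k + i) v) λ t → ι (bad? k L v t)

-- Sizes are indexed by `i = l - k`; since a bad trail has `k ≤ l < n`, its index lies in the range
-- of the sum.
badness-BadTrail : (G : Graph n) → ∀ k (L : ListAssignment n m) → BadTrail G L k → 1 ≤ badness G k L
badness-BadTrail {n} G k L (l , v , t , k≤l , l<n , t∈ , bad) = begin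
  1                                                                 ≡⟨ ι-yes (bad? k L v t) bad ⟨
  ι (bad? k L v t)                                                  ≤⟨ ∑-∈ (trails G (k + i) v) (λ t → ι (bad? k L v t)) (subst (λ l → t LM.∈ trails G l v) (sym (m+[n∸m]≡n k≤l)) t∈) ⟩
  ∑ (trails G (k + i) v) (λ t → ι (bad? k L v t))                   ≤⟨ ∑-∈ (allFin n) (λ v → ∑ (trails G (k + i) v) λ t → ι (bad? k L v t)) (∈-allFin v) ⟩
  ∑ (allFin n) (λ v → ∑ (trails G (k + i) v) λ t → ι (bad? k L v t)) ≤⟨ ∑-∈ (downFrom n) _ (∈-downFrom⁺ (≤-<-trans (m∸n≤m l k) l<n)) ⟩
  badness G k L                                                     ∎
  where
  open ≤-Reasoning
  i = l ∸ k

∑-badness : (G : Graph n) → ∀ m k → ∑ (assignments n m k) (badness G k) ≡ ∑ (downFrom n) (λ i → bad-total G m k (k + i))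
∑-badness {n} G m k =
  trans (∑-swap As (downFrom n) _) (∑-cong (downFrom n) λ i →
  trans (∑-swap As (allFin n) _) (∑-cong (allFin n) λ v →
  ∑-swap As (trails G (k + i) v) _))
  where As = assignments n m k

ι-1≤ : ∀ x → ι (1 ≤? x) ≤ x
ι-1≤ zero = z≤n
ι-1≤ (suc x) = s≤s z≤n

theorem1 : (k : ℕ) → 3 ≤ k →
    (G : (n : ℕ) → Graph n) → (m : ℕ → ℕ) →
    ((n : ℕ) → k ≤ m n) →
    ((C : ℕ) → Σ ℕ λ N → (n : ℕ) → N ≤ n →
    C ^ (k * k) * n * maxDegree (G n) ^ k ≤ m n ^ (k * k)) →
    ((n : ℕ) → 3 * (k * k) * maxDegree (G n) ≤ m n) →
    (j : ℕ) → Σ ℕ λ N → (n : ℕ) → N ≤ n → FailProbAtMost (G n) k (m n) j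
-- The added `suc` forces `n ≥ 1`, so that the factor `n` of the growth hypothesis can be cancelled.
theorem1 k@(suc (suc h)) (s≤s (s≤s _)) G m k≤m m≫ mΔ j = suc (proj₁ (m≫ C₁)) , λ n n≥ →
  S n , UP.filter⁺ (bad n) (assignments-unique n (m n) k) , small n n≥ , colours n
  where
  open ≤-Reasoning
  C₁ = threshold k * suc j
  bad : ∀ n (L : ListAssignment n (m n)) → Dec (1 ≤ badness (G n) k L)
  bad n L = 1 ≤? badness (G n) k L
  S : ∀ n → List (ListAssignment n (m n))
  S n = filter (bad n) (assignments n (m n) k)
  small : ∀ n → suc (proj₁ (m≫ C₁)) ≤ n → suc j * length (S n) ≤ (m n C k) ^ n
  small n n≥ = *-cancelˡ-≤ (suc n) (begin
    suc n * (suc j * length (S n))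
      ≡⟨ cong (λ z → suc n * (suc j * z)) (length-filter (bad n) As) ⟩
    suc n * (suc j * ∑ As (ι ∘ bad n))
      ≤⟨ *-monoʳ-≤ (suc n) (*-monoʳ-≤ (suc j) (∑-mono As λ {L} _ → ι-1≤ (badness (G n) k L))) ⟩
    suc n * (suc j * ∑ As (badness (G n) k))
      ≡⟨ cong (λ z → suc n * (suc j * z)) (∑-badness (G n) (m n) k) ⟩
    suc n * (suc j * ∑ (downFrom n) (λ i → bad-total (G n) (m n) k (k + i)))
      ≡⟨ cong (suc n *_) (∑-* (suc j) (downFrom n) _) ⟨
    suc n * ∑ (downFrom n) (λ i → suc j * bad-total (G n) (m n) k (k + i))
      ≤⟨ telescope (λ i → suc j * bad-total (G n) (m n) k (k + i)) N each n ⟩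
    n * N
      ≤⟨ *-monoˡ-≤ N (n≤1+n n) ⟩
    suc n * N ∎)
    where
    As = assignments n (m n) k
    N = (m n C k) ^ n
    -- Only `i ≤ l` is needed to pass from the factor `(l+1)(l+2)` of `bad-total-small` to that of
    -- `telescope`.
    each : ∀ i → suc j * bad-total (G n) (m n) k (k + i) * (suc i * suc (suc i)) ≤ N
    each i = ≤-trans
      (*-monoʳ-≤ (suc j * bad-total (G n) (m n) k (k + i)) (*-mono-≤ (s≤s (m≤n+m i k)) (s≤s (s≤s (m≤n+m i k)))))
      (bad-total-small (G n) (m n) k j i (≤-trans (s≤s z≤n) n≥) (s≤s z≤n) (k≤m n) (mΔ n)
        (proj₂ (m≫ C₁) n (≤-trans (n≤1+n _) n≥)))
  colours : ∀ n L → IsKLists k L → ¬ (L LM.∈ S n) → Colourable (G n) L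
  colours n L kL L∉S = not-bad (colourable-or-bad (G n) L h kL (colour (m n) (k≤m n)))
    where
    -- The default colour required by `hall`; one exists because `k ≤ m` with `k` positive.
    colour : ∀ m → k ≤ m → Fin m
    colour (suc _) _ = zero
    not-bad : Colourable (G n) L ⊎ BadTrail (G n) L k → Colourable (G n) L
    not-bad (inj₁ c) = c
    not-bad (inj₂ b) = contradiction (∈-filter⁺ (bad n) (∈-assignments L kL) (badness-BadTrail (G n) k L b)) L∉S
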